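{- Let $S_0>0$, let $g:\mathbb R\to\mathbb R$ be continuous, and let $\mathcal U\subset\mathbb R$ be a bounded Borel set containing at least one positive and at least one negative point. Then $$\min_{\Delta\in\mathbb R}\max_{\theta\in\{0,1\}}\max_{R\in\mathcal U}\Bigl((g(S_0(1+R))-\Delta R)(1-\theta)+g(S_0)\theta\Bigr)$$ $$=\max_{\theta\in\{0,1\}}\min_{\Delta\in\mathbb R}\max_{R\in\mathcal U}\Bigl((g(S_0(1+R))-\Delta R)(1-\theta)+g(S_0)\theta\Bigr)$$ $$=\max\Bigl\{\max_{P\in\mathcal P(\mathcal U),\ \mathbb E_P[R]=0}\mathbb E_P[g(S_0(1+R))],\ g(S_0)\Bigr\}.$$
   Context: $\mathcal P(\mathcal U)$ is the set of all Borel probability measures supported on $\mathcal U$; under $P\in\mathcal P(\mathcal U)$ the random variable $R$ has law $P$. As in the paper, "max" over $\mathcal U$ and over measures is to be read as a supremum when it is not attained (e.g. when $\mathcal U$ is not closed). Interpretation: the first expression is the single-round upper bound of an American option with payoff $g$; $\theta=1$ means that the adversary exercises early. -}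

module Defs where

open import Level using (0ℓ) renaming (_⊔_ to _⊔ˡ_; suc to lsuc)
open import Algebra.Bundles using (CommutativeRing)
open import Data.List.Base using (List; []; _∷_)
open import Data.List.Relation.Unary.All using (All)
open import Data.List.Relation.Unary.AllPairs using (AllPairs)
open import Data.Nat.Base using (ℕ; zero; suc) renaming (_≤_ to _≤ⁿ_)
open import Data.Product using (_×_; _,_; ∃; ∃-syntax)
open import Data.Sum using (_⊎_)
open import Function.Base using (_∘_)
open import Relation.Binary.Bundles using (TotalOrder)
open import Relation.Binary.Core using (Rel)
open import Relation.Binary.PropositionalEquality using (_≢_)
open import Relation.Binary.Structures using (IsTotalOrder)
open import Relation.Unary using (Pred; _∈_; Satisfiable; _≐_; _⊥_; ∁; ⋃; _⊢_) renaming (U to Univ)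
import Algebra.Construct.NaturalChoice.Max as Max
import Relation.Binary.Construct.NonStrictToStrict as Strict

-- The real numbers, given by their axioms as a Dedekind-complete ordered
-- field (unique up to isomorphism).  Equality is the setoid equality _≈_.
-- Together with excluded middle, completeness for subsets in Pred ℝ 0ℓ
-- gives completeness for subsets at the universe levels where excluded
-- middle is available.

record CompleteOrderedField : Set₁ where
  field
    commutativeRing : CommutativeRing 0ℓ 0ℓ

  open CommutativeRing commutativeRing public
    using (_≈_; _≉_; _+_; _*_; -_; _-_; 0#; 1#)
    renaming (Carrier to ℝ)

  infix 4 _≤_

  field
    _≤_          : Rel ℝ 0ℓ
    isTotalOrder : IsTotalOrder _≈_ _≤_
    +-monoˡ-≤    : ∀ z {x y} → x ≤ y → x + z ≤ y + z
    *-nonneg     : ∀ {x y} → 0# ≤ x → 0# ≤ y → 0# ≤ x * y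
    0≉1          : 0# ≉ 1#
    inverse      : ∀ {x} → x ≉ 0# → ∃[ y ] x * y ≈ 1#

  IsUpperBound : ∀ {ℓ} → Pred ℝ ℓ → Pred ℝ ℓ
  IsUpperBound A u = ∀ {x} → x ∈ A → x ≤ u

  IsSup : ∀ {ℓ} → Pred ℝ ℓ → Pred ℝ ℓ
  IsSup A s = IsUpperBound A s × (∀ {u} → IsUpperBound A u → s ≤ u)

  field
    complete : (A : Pred ℝ 0ℓ) → Satisfiable A → ∃ (IsUpperBound A) → ∃ (IsSup A)

  totalOrder : TotalOrder 0ℓ 0ℓ 0ℓ
  totalOrder = record { isTotalOrder = isTotalOrder }

  open Max totalOrder public using (_⊔_)
  open Strict _≈_ _≤_ public using (_<_)

module RealAnalysis (𝓡 : CompleteOrderedField) where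

  open CompleteOrderedField 𝓡 public

  infix 9 ∣_∣

  ∣_∣ : ℝ → ℝ
  ∣ x ∣ = x ⊔ (- x)

  -- This ε-δ condition also forces f to respect _≈_.
  Continuous : Pred (ℝ → ℝ) 0ℓ
  Continuous f = ∀ x {ε} → 0# < ε →
    ∃[ δ ] (0# < δ × (∀ y → ∣ y - x ∣ < δ → ∣ f y - f x ∣ < ε))

  Bounded : Pred ℝ 0ℓ → Set
  Bounded A = ∃[ M ] (∀ {x} → x ∈ A → ∣ x ∣ ≤ M)

  IsOpen : Pred ℝ 0ℓ → Set
  IsOpen A = ∀ {x} → x ∈ A → ∃[ ε ] (0# < ε × (∀ y → ∣ y - x ∣ < ε → y ∈ A))

  -- The σ-algebra generated by the open sets.  Subsets are predicates, so
  -- closure under extensional equality of sets is a separate constructor.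
  data Borel : Pred ℝ 0ℓ → Set₁ where
    isOpen     : ∀ {A} → IsOpen A → Borel A
    complement : ∀ {A} → Borel A → Borel (∁ A)
    union      : ∀ {A : ℕ → Pred ℝ 0ℓ} → (∀ n → Borel (A n)) → Borel (⋃ ℕ A)
    resp-≐     : ∀ {A B} → A ≐ B → Borel A → Borel B

  record BorelSet : Set₁ where
    constructor _,ᵇ_
    field
      set     : Pred ℝ 0ℓ
      isBorel : Borel set

  open BorelSet public

  ⋃ᵇ : (ℕ → BorelSet) → BorelSet
  ⋃ᵇ A = ⋃ ℕ (set ∘ A) ,ᵇ union (isBorel ∘ A)

  partialSum : (ℕ → ℝ) → ℕ → ℝ
  partialSum a zero    = 0#
  partialSum a (suc n) = partialSum a n + a n

  HasSum : (ℕ → ℝ) → Pred ℝ 0ℓ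
  HasSum a s = ∀ {ε} → 0# < ε →
    ∃[ N ] (∀ n → N ≤ⁿ n → ∣ partialSum a n - s ∣ < ε)

  -- A Borel probability measure on ℝ.  By prob-cong, prob depends neither on
  -- the proof of Borel measurability nor on the predicate representing a set.
  record ProbabilityMeasure : Set₁ where
    field
      prob       : BorelSet → ℝ
      prob-cong  : ∀ A B → set A ≐ set B → prob A ≈ prob B
      nonneg     : ∀ A → 0# ≤ prob A
      σ-additive : (A : ℕ → BorelSet) →
                   (∀ {i j} → i ≢ j → set (A i) ⊥ set (A j)) →
                   HasSum (prob ∘ A) (prob (⋃ᵇ A))
      total      : ∀ A → set A ≐ Univ → prob A ≈ 1#

  open ProbabilityMeasure public

  -- Measures on ℝ giving full mass to the (not necessarily closed) set U.
  𝒫 : BorelSet → Pred ProbabilityMeasure 0ℓ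
  𝒫 U P = prob P U ≈ 1#

  -- A term (c₁ , A₁) ∷ ⋯ ∷ (cₙ , Aₙ) ∷ [] stands for the function with value
  -- cᵢ on Aᵢ and 0 off all the Aᵢ; this makes sense when the Aᵢ are pairwise
  -- disjoint, as required in _SimpleBelow_.
  SimpleFunction : Set₁
  SimpleFunction = List (ℝ × BorelSet)

  -- 0 ≤ φ ≤ h pointwise, for a nonnegative function h.
  _SimpleBelow_ : SimpleFunction → (ℝ → ℝ) → Set₁
  φ SimpleBelow h =
    AllPairs (λ (_ , A) (_ , B) → set A ⊥ set B) φ ×
    All (λ (c , A) → 0# ≤ c × (∀ {x} → x ∈ set A → c ≤ h x)) φ

  simpleIntegral : ProbabilityMeasure → SimpleFunction → ℝ
  simpleIntegral P []            = 0#
  simpleIntegral P ((c , A) ∷ φ) = c * prob P A + simpleIntegral P φ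

  -- v is the Lebesgue integral ∫ h dP ∈ [0,∞) of the nonnegative function h.
  IsIntegral⁺ : ProbabilityMeasure → (ℝ → ℝ) → Pred ℝ (lsuc 0ℓ)
  IsIntegral⁺ P h = IsSup (λ s → ∃[ φ ] (φ SimpleBelow h × s ≈ simpleIntegral P φ))

  Measurable : (ℝ → ℝ) → Set₁
  Measurable f = ∀ {A} → Borel A → Borel (f ⊢ A)

  -- Suprema, extrema and expectations are partial operations.  An expression
  -- built from them is represented by the predicate "the value of the
  -- expression exists and equals v"; this value is unique up to _≈_.
  Expr : ∀ ℓ → Set (lsuc ℓ)
  Expr ℓ = Pred ℝ ℓ

  infix 4 _≃_

  -- Both sides are defined and have the same value.
  _≃_ : ∀ {ℓ₁ ℓ₂} → Expr ℓ₁ → Expr ℓ₂ → Set (ℓ₁ ⊔ˡ ℓ₂)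
  e₁ ≃ e₂ = ∃[ v ] (v ∈ e₁ × v ∈ e₂)

  val : ℝ → Expr 0ℓ
  val x v = v ≈ x

  -- 𝔼 P f is E_P[f(R)] for R of law P, that is ∫ f⁺ dP − ∫ f⁻ dP, defined
  -- when f is measurable and both integrals are finite.
  𝔼 : ProbabilityMeasure → (ℝ → ℝ) → Expr (lsuc 0ℓ)
  𝔼 P f v = Measurable f ×
    ∃[ a ] ∃[ b ] ( IsIntegral⁺ P (λ x → f x ⊔ 0#) a
                  × IsIntegral⁺ P (λ x → (- f x) ⊔ 0#) b
                  × v ≈ a - b )

  module _ {x a e} {X : Set x} (A : Pred X a) (E : X → Expr e) where

    infixr 5 supOver maxOver minOver

    Defined : Set (x ⊔ˡ a ⊔ˡ e)
    Defined = ∀ {i} → i ∈ A → Satisfiable (E i)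

    Values : Pred ℝ (x ⊔ˡ a ⊔ˡ e)
    Values v = ∃[ i ] (i ∈ A × v ∈ E i)

    supOver : Expr (x ⊔ˡ a ⊔ˡ e)
    supOver v = Defined × IsSup Values v

    -- Unlike supOver, maxOver and minOver require the extremum to be attained.
    maxOver : Expr (x ⊔ˡ a ⊔ˡ e)
    maxOver v = Defined × v ∈ Values × (∀ {w} → w ∈ Values → w ≤ v)

    minOver : Expr (x ⊔ˡ a ⊔ˡ e)
    minOver v = Defined × v ∈ Values × (∀ {w} → w ∈ Values → v ≤ w)

    syntax supOver A (λ i → E) = sup[ i ∈ A ] E
    syntax maxOver A (λ i → E) = max[ i ∈ A ] E
    syntax minOver A (λ i → E) = min[ i ∈ A ] E

  max₂ : ∀ {ℓ₁ ℓ₂} → Expr ℓ₁ → Expr ℓ₂ → Expr (ℓ₁ ⊔ˡ ℓ₂)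
  max₂ e₁ e₂ v = ∃[ a ] ∃[ b ] (a ∈ e₁ × b ∈ e₂ × v ≈ a ⊔ b)

  ｛0,1｝ : Pred ℝ 0ℓ
  ｛0,1｝ θ = θ ≈ 0# ⊎ θ ≈ 1#

{-# OPTIONS --safe #-}
-- Write f R = g (S₀ (1 + R)), and let D be the supremum of q f r + p f s over two-point laws
-- q δᵣ + p δₛ of mean zero with r ≤ 0 < s in 𝒰.  Each two-point law prevents every hedge Δ from
-- bringing sup (f R − Δ R) below D.  Conversely let Δ* be the supremum of the slopes (f s − D) / s
-- over s > 0 in 𝒰: comparing a slope at r < 0 with one at s > 0 through the two-point law on {r, s}
-- shows that f R − Δ* R ≤ D throughout 𝒰, so Δ* is optimal.  Integrating that inequality bounds
-- E_P[f] by D for every P of mean zero.  Expectations are compared with finite sums over a tagged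
-- Borel partition of 𝒰 on whose pieces f and the identity oscillate by at most ε; the suprema and
-- infima over θ and Δ then reduce to the maximum of D and g S₀.

module Submission where

open import Defs
open import Algebra.Bundles using (CommutativeRing)
import Algebra.Properties.Ring as RingProperties
import Algebra.Properties.Semiring.Mult.TCOptimised as Multiples
import Algebra.Solver.Ring as RingSolver
open import Algebra.Solver.Ring.AlmostCommutativeRing using (fromCommutativeRing; _-Raw-AlmostCommutative⟶_)
open import Axiom.ExcludedMiddle using (ExcludedMiddle)
open import Data.Empty using (⊥-elim)
open import Data.Integer.Base as ℤ using (ℤ; +_; -[1+_]; _⊖_)
import Data.Integer.Properties as ℤ
open import Data.List.Base using (List; []; _∷_; map; _++_)
open import Data.List.Relation.Unary.All as All using (All; []; _∷_)
import Data.List.Relation.Unary.All.Properties as All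
open import Data.List.Relation.Unary.AllPairs using (AllPairs; []; _∷_)
import Data.List.Relation.Unary.AllPairs.Properties as AllPairs
open import Data.List.Relation.Unary.Any as Any using (Any; here; there)
import Data.List.Relation.Unary.Any.Properties as Any
import Data.Maybe.Base as Maybe
open import Data.Nat.Base as ℕ using (ℕ; zero; suc; s≤s) renaming (_+_ to _+ⁿ_; _≤_ to _≤ⁿ_; _⊔_ to _⊔ⁿ_)
import Data.Nat.Properties as ℕ
open import Data.Product using (_×_; _,_; ∃; ∃-syntax; proj₁; proj₂; map₁)
open import Data.Sum using (_⊎_; inj₁; inj₂; [_,_]′)
open import Data.Unit.Base using (tt)
open import Function.Base using (_∘_; id)
open import Level using (0ℓ; Lift; lift; lower) renaming (suc to lsuc)
open import Relation.Binary.PropositionalEquality as ≡ using (_≢_)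
import Relation.Binary.Reasoning.Setoid as SetoidReasoning
open import Relation.Binary.Structures using (IsTotalOrder)
open import Relation.Nullary using (¬_; Dec; yes; no)
open import Relation.Nullary.Decidable using (dec⇒maybe; True; toWitness; fromWitness; map′; decidable-stable)
open import Relation.Unary using (Pred; _∈_; Satisfiable; _∉_; _≐_; _⊥_; _⊆_; _∪_; _∩_; ∁; ⋃) renaming (U to Univ; ∅ to Empty)

-- Since 𝒰 may fail to be closed, compactness cannot supply an extremal law or a worst return: D and
-- the worst cases are suprema, and only the extrema over Δ and θ are attained. D is the value at 0
-- of the concave envelope of f on 𝒰, and Δ* is the slope of a line through (0, D) that lies above
-- the graph of f on 𝒰. Such a slope must dominate the slopes from points s > 0 and stay below those
-- from points r < 0; a positive point of 𝒰 makes the first family nonempty, and a negative one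
-- bounds it above, so completeness yields Δ*. The integral is a supremum over simple functions, a
-- form from which additivity is not immediate. The proof never establishes additivity: the
-- expectations of f and of the identity are compared with sums over the same tagged pieces, where
-- linearity is elementary, and the error is then sent to zero.

-- Ring solver with integer coefficients.

module IntegerCoefficients (R : CommutativeRing 0ℓ 0ℓ) where
  open CommutativeRing R
  open RingProperties ring using (-0#≈0#; -‿involutive; -‿distribˡ-*; -‿distribʳ-*; -‿+-comm)
  open Multiples semiring using (×-homo-+; ×1-homo-*; 1+×) renaming (_×_ to _×ⁿ_)
  open SetoidReasoning setoid

  -- The solver normalises by deciding equality of coefficients. Equality of integers can be decided
  -- by computation, so numerals are taken there and mapped into the ring.
  fromℤ : ℤ → Carrier
  fromℤ (+ n)    = n ×ⁿ 1#
  fromℤ -[1+ n ] = - (suc n ×ⁿ 1#)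

  fromℤ-neg : ∀ i → fromℤ (ℤ.- i) ≈ - fromℤ i
  fromℤ-neg (+ zero)  = sym -0#≈0#
  fromℤ-neg (+ suc n) = refl
  fromℤ-neg -[1+ n ]  = sym (-‿involutive _)

  fromℤ-⊖ : ∀ m n → fromℤ (m ⊖ n) ≈ m ×ⁿ 1# - n ×ⁿ 1#
  fromℤ-⊖ m zero = begin
    m ×ⁿ 1#         ≈⟨ +-identityʳ _ ⟨
    m ×ⁿ 1# + 0#    ≈⟨ +-congˡ -0#≈0# ⟨
    m ×ⁿ 1# + - 0#  ∎
  fromℤ-⊖ zero (suc n) = sym (+-identityˡ _)
  fromℤ-⊖ (suc m) (suc n) = begin
    fromℤ (suc m ⊖ suc n)             ≡⟨ ≡.cong fromℤ (ℤ.[1+m]⊖[1+n]≡m⊖n m n) ⟩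
    fromℤ (m ⊖ n)                     ≈⟨ fromℤ-⊖ m n ⟩
    a - b                             ≈⟨ +-identityˡ _ ⟨
    0# + (a - b)                      ≈⟨ +-congʳ (-‿inverseʳ 1#) ⟨
    (1# - 1#) + (a - b)               ≈⟨ +-assoc _ _ _ ⟩
    1# + (- 1# + (a - b))             ≈⟨ +-congˡ (+-assoc _ _ _) ⟨
    1# + ((- 1# + a) - b)             ≈⟨ +-congˡ (+-congʳ (+-comm _ _)) ⟩
    1# + ((a - 1#) - b)               ≈⟨ +-congˡ (+-assoc _ _ _) ⟩
    1# + (a + (- 1# - b))             ≈⟨ +-assoc _ _ _ ⟨
    (1# + a) + (- 1# - b)             ≈⟨ +-congˡ (-‿+-comm _ _) ⟩
    (1# + a) - (1# + b)               ≈⟨ +-cong (1+× m 1#) (-‿cong (1+× n 1#)) ⟨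
    suc m ×ⁿ 1# - suc n ×ⁿ 1#         ∎
    where
    a = m ×ⁿ 1#
    b = n ×ⁿ 1#

  fromℤ-+ : ∀ i j → fromℤ (i ℤ.+ j) ≈ fromℤ i + fromℤ j
  fromℤ-+ (+ m)    (+ n)    = ×-homo-+ 1# m n
  fromℤ-+ (+ m)    -[1+ n ] = fromℤ-⊖ m (suc n)
  fromℤ-+ -[1+ m ] (+ n)    = trans (fromℤ-⊖ n (suc m)) (+-comm _ _)
  fromℤ-+ -[1+ m ] -[1+ n ] = begin
    - (suc (suc (m ℕ.+ n)) ×ⁿ 1#)        ≡⟨ ≡.cong (λ k → - (suc k ×ⁿ 1#)) (≡.sym (ℕ.+-suc m n)) ⟩
    - ((suc m ℕ.+ suc n) ×ⁿ 1#)          ≈⟨ -‿cong (×-homo-+ 1# (suc m) (suc n)) ⟩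
    - (suc m ×ⁿ 1# + suc n ×ⁿ 1#)        ≈⟨ -‿+-comm _ _ ⟨
    - (suc m ×ⁿ 1#) + - (suc n ×ⁿ 1#)    ∎

  fromℤ-pos* : ∀ m n → fromℤ (+ m ℤ.* + n) ≈ fromℤ (+ m) * fromℤ (+ n)
  fromℤ-pos* m n = begin
    fromℤ (+ m ℤ.* + n)    ≡⟨ ≡.cong fromℤ (ℤ.pos-* m n) ⟨
    (m ℕ.* n) ×ⁿ 1#        ≈⟨ ×1-homo-* m n ⟩
    m ×ⁿ 1# * n ×ⁿ 1#      ∎

  fromℤ-pos*ˡ : ∀ m j → fromℤ (+ m ℤ.* j) ≈ fromℤ (+ m) * fromℤ j
  fromℤ-pos*ˡ m (+ n)    = fromℤ-pos* m n
  fromℤ-pos*ˡ m -[1+ n ] = begin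
    fromℤ (+ m ℤ.* (ℤ.- + suc n))      ≡⟨ ≡.cong fromℤ (ℤ.neg-distribʳ-* (+ m) (+ suc n)) ⟨
    fromℤ (ℤ.- (+ m ℤ.* + suc n))      ≈⟨ fromℤ-neg (+ m ℤ.* + suc n) ⟩
    - fromℤ (+ m ℤ.* + suc n)          ≈⟨ -‿cong (fromℤ-pos* m (suc n)) ⟩
    - (fromℤ (+ m) * fromℤ (+ suc n))  ≈⟨ -‿distribʳ-* _ _ ⟩
    fromℤ (+ m) * - fromℤ (+ suc n)    ∎

  fromℤ-* : ∀ i j → fromℤ (i ℤ.* j) ≈ fromℤ i * fromℤ j
  fromℤ-* (+ m)    j = fromℤ-pos*ˡ m j
  fromℤ-* -[1+ m ] j = begin
    fromℤ ((ℤ.- + suc m) ℤ.* j)        ≡⟨ ≡.cong fromℤ (ℤ.neg-distribˡ-* (+ suc m) j) ⟨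
    fromℤ (ℤ.- (+ suc m ℤ.* j))        ≈⟨ fromℤ-neg (+ suc m ℤ.* j) ⟩
    - fromℤ (+ suc m ℤ.* j)            ≈⟨ -‿cong (fromℤ-pos*ˡ (suc m) j) ⟩
    - (fromℤ (+ suc m) * fromℤ j)      ≈⟨ -‿distribˡ-* _ _ ⟩
    (- fromℤ (+ suc m)) * fromℤ j      ∎

  homomorphism : ℤ.+-*-rawRing -Raw-AlmostCommutative⟶ fromCommutativeRing R
  homomorphism = record
    { ⟦_⟧    = fromℤ
    ; +-homo = fromℤ-+
    ; *-homo = fromℤ-*
    ; -‿homo = fromℤ-neg
    ; 0-homo = refl
    ; 1-homo = refl
    }

  open RingSolver ℤ.+-*-rawRing (fromCommutativeRing R) homomorphism
    (λ i j → Maybe.map (λ i≡j → reflexive (≡.cong fromℤ i≡j)) (dec⇒maybe (i ℤ.≟ j)))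
    public using (solve; _:=_; _:+_; _:*_; _:-_; :-_; con)

-- Order, absolute value and linear arithmetic in the reals.

module OrderedField (em : ExcludedMiddle (lsuc 0ℓ)) (𝓡 : CompleteOrderedField) where
  open RealAnalysis 𝓡 public
  open CommutativeRing commutativeRing public
    using (refl; sym; trans; +-cong; +-congˡ; +-congʳ; *-cong; *-congˡ; *-congʳ; -‿cong
          ; +-identityˡ; +-identityʳ; *-identityˡ; *-identityʳ; zeroˡ; zeroʳ; -‿inverseʳ)
  open IntegerCoefficients commutativeRing public using (solve; _:=_; _:+_; _:*_; _:-_; :-_; con)
  open IsTotalOrder isTotalOrder public
    using (antisym; ≤-respˡ-≈; ≤-respʳ-≈)
    renaming (total to ≤-total; refl to ≤-refl; trans to ≤-trans; reflexive to ≤-reflexive)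

  abstract
    em₀ : ∀ {P : Set} → Dec P
    em₀ {P} = map′ lower lift (em {Lift (lsuc 0ℓ) P})

    -- `True` of a decision is a small type, so excluded middle replaces A by an equivalent
    -- predicate to which `complete` applies. Integrals and covers need the larger level because
    -- they quantify over Borel sets.
    completeness : (A : Pred ℝ (lsuc 0ℓ)) → Satisfiable A → ∃ (IsUpperBound A) → ∃ (IsSup A)
    completeness A (a , a∈A) (u , A≤u)
      with complete (λ x → True (em {A x})) (a , fromWitness a∈A) (u , λ x∈A → A≤u (toWitness x∈A))
    ... | s , A≤s , s≤ = s , (λ x∈A → A≤s (fromWitness x∈A)) , λ A≤v → s≤ (λ x∈A → A≤v (toWitness x∈A))

    sup-unique : ∀ {ℓ} {A : Pred ℝ ℓ} {s t} → IsSup A s → IsSup A t → s ≈ t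
    sup-unique (A≤s , s≤) (A≤t , t≤) = antisym (s≤ A≤t) (t≤ A≤s)

    -0≈0 : - 0# ≈ 0#
    -0≈0 = solve 0 (:- con (+ 0) := con (+ 0)) refl

    x-0≈x : ∀ x → x - 0# ≈ x
    x-0≈x = solve 1 (λ x → x :- con (+ 0) := x) refl

    -- Linear arithmetic: an inequality follows from others once the difference of its sides
    -- is the sum of theirs, an identity left to the ring solver.

    ≤⇒0≤- : ∀ {x y} → x ≤ y → 0# ≤ y - x
    ≤⇒0≤- {x} x≤y = ≤-respˡ-≈ (-‿inverseʳ x) (+-monoˡ-≤ (- x) x≤y)

    by₀ : ∀ {x y w} → 0# ≤ w → y - x ≈ w → x ≤ y
    by₀ {x} {y} {w} 0≤w eq = ≤-respˡ-≈ (+-identityˡ x)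
      (≤-respʳ-≈ (trans (+-congʳ (sym eq)) (solve 2 (λ x y → (y :- x) :+ x := y) refl x y)) (+-monoˡ-≤ x 0≤w))

    0≤-+ : ∀ {x y} → 0# ≤ x → 0# ≤ y → 0# ≤ x + y
    0≤-+ {x} {y} 0≤x 0≤y = ≤-trans 0≤y (≤-respˡ-≈ (+-identityˡ y) (+-monoˡ-≤ y 0≤x))

    by₁ : ∀ {a b x y} → a ≤ b → y - x ≈ b - a → x ≤ y
    by₁ a≤b = by₀ (≤⇒0≤- a≤b)

    by₂ : ∀ {a b c d x y} → a ≤ b → c ≤ d → y - x ≈ (b - a) + (d - c) → x ≤ y
    by₂ a≤b c≤d = by₀ (0≤-+ (≤⇒0≤- a≤b) (≤⇒0≤- c≤d))

    by₃ : ∀ {a b c d e f x y} → a ≤ b → c ≤ d → e ≤ f → y - x ≈ (b - a) + ((d - c) + (f - e)) → x ≤ y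
    by₃ a≤b c≤d e≤f = by₀ (0≤-+ (≤⇒0≤- a≤b) (0≤-+ (≤⇒0≤- c≤d) (≤⇒0≤- e≤f)))

    *-monoˡ-≤ : ∀ {k x y} → 0# ≤ k → x ≤ y → k * x ≤ k * y
    *-monoˡ-≤ {k} {x} {y} 0≤k x≤y = by₀ (*-nonneg 0≤k (≤⇒0≤- x≤y))
      (solve 3 (λ k x y → k :* y :- k :* x := k :* (y :- x)) refl k x y)

    *-monoʳ-≤ : ∀ {k x y} → 0# ≤ k → x ≤ y → x * k ≤ y * k
    *-monoʳ-≤ {k} {x} {y} 0≤k x≤y = by₀ (*-nonneg 0≤k (≤⇒0≤- x≤y))
      (solve 3 (λ k x y → y :* k :- x :* k := k :* (y :- x)) refl k x y)

    +-mono-≤ : ∀ {a b c d} → a ≤ b → c ≤ d → a + c ≤ b + d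
    +-mono-≤ {a} {b} {c} {d} a≤b c≤d = by₂ a≤b c≤d
      (solve 4 (λ a b c d → (b :+ d) :- (a :+ c) := (b :- a) :+ (d :- c)) refl a b c d)

    neg-mono-≤ : ∀ {a b} → a ≤ b → - b ≤ - a
    neg-mono-≤ {a} {b} a≤b = by₁ a≤b (solve 2 (λ a b → (:- a) :- (:- b) := b :- a) refl a b)

    <⇒≤ : ∀ {x y} → x < y → x ≤ y
    <⇒≤ = proj₁

    ≰⇒> : ∀ {x y} → ¬ x ≤ y → y < x
    ≰⇒> {x} {y} x≰y with ≤-total x y
    ... | inj₁ x≤y = ⊥-elim (x≰y x≤y)
    ... | inj₂ y≤x = y≤x , λ y≈x → x≰y (≤-reflexive (sym y≈x))

    <⇒≱ : ∀ {x y} → x < y → ¬ y ≤ x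
    <⇒≱ (x≤y , x≉y) y≤x = x≉y (antisym x≤y y≤x)

    ≤-<-connex : ∀ x y → x ≤ y ⊎ y < x
    ≤-<-connex x y with em₀ {x ≤ y}
    ... | yes x≤y = inj₁ x≤y
    ... | no x≰y = inj₂ (≰⇒> x≰y)

    <-≤-trans : ∀ {x y z} → x < y → y ≤ z → x < z
    <-≤-trans x<y y≤z = ≰⇒> (λ z≤x → <⇒≱ x<y (≤-trans y≤z z≤x))

    ≤-<-trans : ∀ {x y z} → x ≤ y → y < z → x < z
    ≤-<-trans x≤y y<z = ≰⇒> (λ z≤x → <⇒≱ y<z (≤-trans z≤x x≤y))

    <-respʳ : ∀ {x y z} → y ≈ z → x < y → x < z
    <-respʳ y≈z x<y = <-≤-trans x<y (≤-reflexive y≈z)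

    <-respˡ : ∀ {x y z} → x ≈ y → x < z → y < z
    <-respˡ x≈y x<z = ≤-<-trans (≤-reflexive (sym x≈y)) x<z

    <⇒0<- : ∀ {x y} → x < y → 0# < y - x
    <⇒0<- {x} {y} x<y = ≰⇒> λ y-x≤0 → <⇒≱ x<y (by₁ y-x≤0
      (solve 2 (λ x y → x :- y := con (+ 0) :- (y :- x)) refl x y))

    by₀< : ∀ {x y w} → 0# < w → y - x ≈ w → x < y
    by₀< {x} {y} {w} 0<w eq = ≰⇒> λ y≤x → <⇒≱ 0<w (≤-respˡ-≈ eq (by₁ y≤x
      (solve 2 (λ x y → con (+ 0) :- (y :- x) := x :- y) refl x y)))

    by₁< : ∀ {a b x y} → a < b → y - x ≈ b - a → x < y
    by₁< a<b = by₀< (<⇒0<- a<b)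

    0≤∧0<⇒0<+ : ∀ {x y} → 0# ≤ x → 0# < y → 0# < x + y
    0≤∧0<⇒0<+ {x} {y} 0≤x 0<y = <-≤-trans 0<y (by₀ 0≤x (solve 2 (λ x y → (x :+ y) :- y := x) refl x y))

    by₂< : ∀ {a b c d x y} → a ≤ b → c < d → y - x ≈ (b - a) + (d - c) → x < y
    by₂< a≤b c<d = by₀< (0≤∧0<⇒0<+ (≤⇒0≤- a≤b) (<⇒0<- c<d))

    square-nonneg : ∀ x → 0# ≤ x * x
    square-nonneg x with ≤-total 0# x
    ... | inj₁ 0≤x = *-nonneg 0≤x 0≤x
    ... | inj₂ x≤0 = ≤-respʳ-≈ (solve 1 (λ x → (con (+ 0) :- x) :* (con (+ 0) :- x) := x :* x) refl x)
                       (*-nonneg (≤⇒0≤- x≤0) (≤⇒0≤- x≤0))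

    0<1 : 0# < 1#
    0<1 = ≤-respʳ-≈ (*-identityˡ 1#) (square-nonneg 1#) , 0≉1

    inverse-pos : ∀ {x} → 0# < x → ∃[ y ] (0# < y × x * y ≈ 1#)
    inverse-pos {x} 0<x with inverse (λ x≈0 → proj₂ 0<x (sym x≈0))
    ... | y , xy≈1 = y , ≰⇒> (λ y≤0 → <⇒≱ 0<1 (≤-respˡ-≈ xy≈1 (≤-respʳ-≈ (zeroʳ x) (*-monoˡ-≤ (<⇒≤ 0<x) y≤0)))) , xy≈1

    *-pos : ∀ {x y} → 0# < x → 0# < y → 0# < x * y
    *-pos {x} {y} 0<x 0<y with inverse-pos 0<x
    ... | x⁻¹ , 0<x⁻¹ , xx⁻¹≈1 = *-nonneg (<⇒≤ 0<x) (<⇒≤ 0<y) , λ 0≈xy → proj₂ 0<y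
      (trans (sym (zeroʳ x⁻¹)) (trans (*-congˡ 0≈xy)
        (trans (solve 3 (λ x y z → z :* (x :* y) := (x :* z) :* y) refl x y x⁻¹)
          (trans (*-congʳ xx⁻¹≈1) (*-identityˡ y)))))

    halve : ∀ {ε} → 0# < ε → ∃[ h ] (0# < h × h + h ≈ ε)
    halve {ε} 0<ε =
      let ½ , 0<½ , 2½≈1 = inverse-pos (0≤∧0<⇒0<+ (<⇒≤ 0<1) 0<1) in
      ε * ½ , *-pos 0<ε 0<½ ,
      trans (solve 2 (λ ε h → ε :* h :+ ε :* h := ε :* ((con (+ 1) :+ con (+ 1)) :* h)) refl ε ½)
        (trans (*-congˡ 2½≈1) (*-identityʳ ε))

    ≤-by-approximation : ∀ {K x y} → 0# ≤ K → (∀ {ε} → 0# < ε → x ≤ y + K * ε) → x ≤ y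
    ≤-by-approximation {K} {x} {y} 0≤K approx = [ id , (λ y<x → ⊥-elim (absurd y<x)) ]′ (≤-<-connex x y)
      where
      absurd : ¬ y < x
      absurd y<x =
        -- Take ε = (x - y) / (K + 1). Then K ε = (x - y) - ε, so the hypothesis would give ε ≤ 0.
        -- Adding 1 keeps the denominator positive when K is 0.
        let k , 0<k , K+1*k≈1 = inverse-pos (0≤∧0<⇒0<+ 0≤K 0<1)
            0<ε = *-pos (<⇒0<- y<x) 0<k in
        <⇒≱ 0<ε (by₁ (approx 0<ε) (trans
            (solve 4 (λ K x y k → con (+ 0) :- (x :- y) :* k :=
                                  (y :+ K :* ((x :- y) :* k)) :- (y :+ (x :- y) :* ((K :+ con (+ 1)) :* k)))
               refl K x y k)
            (+-congˡ (-‿cong (trans (+-congˡ (trans (*-congˡ K+1*k≈1) (*-identityʳ _)))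
               (solve 2 (λ x y → y :+ (x :- y) := x) refl x y))))))

    ⊔-cases : ∀ x y → (y ≤ x × x ⊔ y ≈ x) ⊎ (x ≤ y × x ⊔ y ≈ y)
    ⊔-cases x y with ≤-total x y
    ... | inj₁ x≤y = inj₂ (x≤y , x≤y⇒x⊔y≈y x≤y)
      where open import Algebra.Construct.NaturalChoice.Max totalOrder using (x≤y⇒x⊔y≈y)
    ... | inj₂ y≤x = inj₁ (y≤x , x≤y⇒y⊔x≈y y≤x)
      where open import Algebra.Construct.NaturalChoice.Max totalOrder using (x≤y⇒y⊔x≈y)

    x≤x⊔y : ∀ x y → x ≤ x ⊔ y
    x≤x⊔y x y with ⊔-cases x y
    ... | inj₁ (_ , eq) = ≤-reflexive (sym eq)
    ... | inj₂ (x≤y , eq) = ≤-trans x≤y (≤-reflexive (sym eq))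

    y≤x⊔y : ∀ x y → y ≤ x ⊔ y
    y≤x⊔y x y with ⊔-cases x y
    ... | inj₁ (y≤x , eq) = ≤-trans y≤x (≤-reflexive (sym eq))
    ... | inj₂ (_ , eq) = ≤-reflexive (sym eq)

    ⊔-lub : ∀ {x y z} → x ≤ z → y ≤ z → x ⊔ y ≤ z
    ⊔-lub {x} {y} x≤z y≤z with ⊔-cases x y
    ... | inj₁ (_ , eq) = ≤-trans (≤-reflexive eq) x≤z
    ... | inj₂ (_ , eq) = ≤-trans (≤-reflexive eq) y≤z

    ⊔-lub-< : ∀ {x y z} → x < z → y < z → x ⊔ y < z
    ⊔-lub-< {x} {y} x<z y<z with ⊔-cases x y
    ... | inj₁ (_ , eq) = ≤-<-trans (≤-reflexive eq) x<z
    ... | inj₂ (_ , eq) = ≤-<-trans (≤-reflexive eq) y<z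

    ⊔-cong : ∀ {x x′ y y′} → x ≈ x′ → y ≈ y′ → x ⊔ y ≈ x′ ⊔ y′
    ⊔-cong {x} {x′} {y} {y′} x≈x′ y≈y′ = antisym
      (⊔-lub (≤-trans (≤-reflexive x≈x′) (x≤x⊔y x′ y′)) (≤-trans (≤-reflexive y≈y′) (y≤x⊔y x′ y′)))
      (⊔-lub (≤-trans (≤-reflexive (sym x≈x′)) (x≤x⊔y x y)) (≤-trans (≤-reflexive (sym y≈y′)) (y≤x⊔y x y)))

    x≤∣x∣ : ∀ x → x ≤ ∣ x ∣
    x≤∣x∣ x = x≤x⊔y x (- x)

    -x≤∣x∣ : ∀ x → - x ≤ ∣ x ∣
    -x≤∣x∣ x = y≤x⊔y x (- x)

    0≤∣x∣ : ∀ x → 0# ≤ ∣ x ∣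
    0≤∣x∣ x with ≤-total 0# x
    ... | inj₁ 0≤x = ≤-trans 0≤x (x≤∣x∣ x)
    ... | inj₂ x≤0 = ≤-trans (≤-respˡ-≈ -0≈0 (neg-mono-≤ x≤0)) (-x≤∣x∣ x)

    pos-neg-part : ∀ x → (x ⊔ 0#) - ((- x) ⊔ 0#) ≈ x
    pos-neg-part x with ⊔-cases x 0# | ⊔-cases (- x) 0#
    ... | inj₁ (0≤x , eq) | inj₂ (-x≤0 , eq′) = trans (+-cong eq (-‿cong eq′)) (x-0≈x x)
    ... | inj₂ (x≤0 , eq) | inj₁ (0≤-x , eq′) = trans (+-cong eq (-‿cong eq′))
            (solve 1 (λ x → con (+ 0) :- (:- x) := x) refl x)
    ... | inj₁ (0≤x , eq) | inj₁ (0≤-x , eq′) = trans (+-cong eq (-‿cong (trans eq′ (trans (-‿cong x≈0) -0≈0)))) (x-0≈x x)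
      where
      x≈0 : x ≈ 0#
      x≈0 = antisym (by₁ 0≤-x (solve 1 (λ x → con (+ 0) :- x := (:- x) :- con (+ 0)) refl x)) 0≤x
    ... | inj₂ (x≤0 , eq) | inj₂ (-x≤0 , eq′) = trans (+-cong eq (-‿cong eq′)) (trans (x-0≈x 0#) (antisym 0≤x x≤0))
      where
      0≤x : 0# ≤ x
      0≤x = by₁ -x≤0 (solve 1 (λ x → x :- con (+ 0) := con (+ 0) :- (:- x)) refl x)

-- Borel sets, finite additivity and sums over tagged pieces.

module Measure (em : ExcludedMiddle (lsuc 0ℓ)) (𝓡 : CompleteOrderedField) where
  open OrderedField em 𝓡

  private
    pair : {X : Set₁} → X → X → X → ℕ → X
    pair a b c zero          = a
    pair a b c (suc zero)    = b
    pair a b c (suc (suc _)) = c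

  ∅ᵇ : BorelSet
  ∅ᵇ = Empty ,ᵇ isOpen λ ()

  Univᵇ : BorelSet
  Univᵇ = Univ ,ᵇ isOpen λ _ → 1# , 0<1 , λ _ _ → tt

  private
    ⋃-pair : (A B : BorelSet) → set (⋃ᵇ (pair A B ∅ᵇ)) ≐ (set A ∪ set B)
    ⋃-pair A B = (λ { (zero , x∈A) → inj₁ x∈A ; (suc zero , x∈B) → inj₂ x∈B ; (suc (suc _) , ()) })
               , (λ { (inj₁ x∈A) → zero , x∈A ; (inj₂ x∈B) → suc zero , x∈B })

  _∪ᵇ_ : BorelSet → BorelSet → BorelSet
  A ∪ᵇ B = (set A ∪ set B) ,ᵇ resp-≐ (⋃-pair A B) (isBorel (⋃ᵇ (pair A B ∅ᵇ)))

  ∁ᵇ : BorelSet → BorelSet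
  ∁ᵇ A = ∁ (set A) ,ᵇ complement (isBorel A)

  abstract
    ∩-borel : (A B : BorelSet) → Borel (set A ∩ set B)
    ∩-borel A B = resp-≐ (to , from) (complement (isBorel (∁ᵇ A ∪ᵇ ∁ᵇ B)))
      where
      to : ∁ (∁ (set A) ∪ ∁ (set B)) ⊆ (set A ∩ set B)
      to n = decidable-stable em₀ (λ x∉A → n (inj₁ x∉A)) , decidable-stable em₀ (λ x∉B → n (inj₂ x∉B))
      from : (set A ∩ set B) ⊆ ∁ (∁ (set A) ∪ ∁ (set B))
      from (x∈A , _)   (inj₁ x∉A) = x∉A x∈A
      from (_   , x∈B) (inj₂ x∉B) = x∉B x∈B

  _∩ᵇ_ : BorelSet → BorelSet → BorelSet
  A ∩ᵇ B = (set A ∩ set B) ,ᵇ ∩-borel A B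

  _∖ᵇ_ : BorelSet → BorelSet → BorelSet
  A ∖ᵇ B = A ∩ᵇ ∁ᵇ B

  infixl 7 _∩ᵇ_ _∖ᵇ_
  infixl 6 _∪ᵇ_

  abstract
    Ioi-open : ∀ u → IsOpen (u <_)
    Ioi-open u {x} u<x = x - u , <⇒0<- u<x , λ y ∣y-x∣<x-u →
      by₁< (≤-<-trans (-x≤∣x∣ (y - x)) ∣y-x∣<x-u)
        (solve 3 (λ u x y → y :- u := (x :- u) :- (:- (y :- x))) refl u x y)

  Ioi : ℝ → BorelSet
  Ioi u = (u <_) ,ᵇ isOpen (Ioi-open u)

  -- Besides a simple function, a list of pairs (t , A) stands for a partition into pieces A with tags t.
  Σ[_] : ProbabilityMeasure → (ℝ → ℝ) → List (ℝ × BorelSet) → ℝ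
  Σ[ P ] F []            = 0#
  Σ[ P ] F ((t , A) ∷ π) = F t * prob P A + Σ[ P ] F π

  Disjoint : List (ℝ × BorelSet) → Set₁
  Disjoint = AllPairs (λ (_ , A) (_ , B) → set A ⊥ set B)

  -- The pieces have to carry full mass, not to exhaust the line, so that a cover of 𝒰 is a
  -- partition for every measure in `𝒫 𝒰`.
  IsPartition : ProbabilityMeasure → List (ℝ × BorelSet) → Set₁
  IsPartition P π = Disjoint π × Σ[ P ] (λ _ → 1#) π ≈ 1#

  Close : (ℝ → ℝ) → ℝ → List (ℝ × BorelSet) → Set₁
  Close f ε = All (λ (t , A) → ∀ {x} → x ∈ set A → f x ≤ f t + ε × f t ≤ f x + ε)

  abstract
    squeeze : ∀ {x y} → (∀ {ε} → 0# < ε → ∣ x - y ∣ < ε) → x ≈ y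
    squeeze {x} {y} close = antisym
      (≤-by-approximation (<⇒≤ 0<1) λ {ε} 0<ε → by₁ (≤-trans (x≤∣x∣ (x - y)) (<⇒≤ (close 0<ε)))
        (solve 3 (λ x y ε → (y :+ con (+ 1) :* ε) :- x := ε :- (x :- y)) refl x y ε))
      (≤-by-approximation (<⇒≤ 0<1) λ {ε} 0<ε → by₁ (≤-trans (-x≤∣x∣ (x - y)) (<⇒≤ (close 0<ε)))
        (solve 3 (λ x y ε → (x :+ con (+ 1) :* ε) :- y := ε :- (:- (x :- y))) refl x y ε))

    -- The index N + m is past both the threshold N of convergence and the point m from which the
    -- partial sums are constant.
    sum-unique : ∀ {a s} (m : ℕ) (l : ℝ) → HasSum a s → (∀ k → partialSum a (k +ⁿ m) ≈ l) → s ≈ l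
    sum-unique {a} {s} m l sums eventually = sym (squeeze λ 0<ε →
      let N , close = sums 0<ε in
      ≤-<-trans (≤-reflexive (⊔-cong (+-congʳ (sym (eventually N))) (-‿cong (+-congʳ (sym (eventually N))))))
        (close _ (ℕ.m≤m+n N m)))

    -- For the constant sequence of empty sets, P ∅ + P ∅ ≈ P ∅ because the partial sums converge.
    prob-∅ : ∀ P → prob P ∅ᵇ ≈ 0#
    prob-∅ P = squeeze λ {ε} 0<ε →
      let h , 0<h , h+h≈ε = halve 0<ε
          N , close = σ-additive P (λ _ → ∅ᵇ) (λ _ ()) 0<h
          p = prob P ∅ᵇ
          q = prob P (⋃ᵇ (λ _ → ∅ᵇ))
          s = partialSum (λ _ → p) N
          s+p<q+h = ≤-<-trans (x≤∣x∣ ((s + p) - q)) (close (suc N) (ℕ.n≤1+n N))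
          q<s+h = ≤-<-trans (-x≤∣x∣ (s - q)) (close N ℕ.≤-refl)
          p<ε = <-respʳ h+h≈ε (by₂< (<⇒≤ s+p<q+h) q<s+h
                  (solve 4 (λ p q s h → (h :+ h) :- p := (h :- ((s :+ p) :- q)) :+ (h :- (:- (s :- q)))) refl p q s h))
      in ⊔-lub-< (<-respˡ (sym (x-0≈x p)) p<ε)
                 (≤-<-trans (by₀ (nonneg P ∅ᵇ)
                   (solve 1 (λ p → con (+ 0) :- (:- (p :- con (+ 0))) := p) refl p)) 0<ε)

    prob-empty : ∀ P A → (∀ {x} → x ∉ set A) → prob P A ≈ 0#
    prob-empty P A empty = trans (prob-cong P A ∅ᵇ ((λ x∈A → empty x∈A) , λ ())) (prob-∅ P)

    -- Countable additivity is applied to the sequence A, B, ∅, ∅, ..., whose partial sums are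
    -- constant from index 2 on by `prob-∅`.
    prob-∪ : ∀ P A B → set A ⊥ set B → prob P (A ∪ᵇ B) ≈ prob P A + prob P B
    prob-∪ P A B A⊥B = trans (prob-cong P (A ∪ᵇ B) (⋃ᵇ S) (proj₂ (⋃-pair A B) , proj₁ (⋃-pair A B)))
      (sum-unique 2 _ (σ-additive P S disjoint) eventually)
      where
      S : ℕ → BorelSet
      S = pair A B ∅ᵇ
      disjoint : ∀ {i j} → i ≢ j → set (S i) ⊥ set (S j)
      disjoint {zero} {zero} i≢j _ = i≢j ≡.refl
      disjoint {zero} {suc zero} _ x = A⊥B x
      disjoint {zero} {suc (suc _)} _ (_ , ())
      disjoint {suc zero} {zero} _ (x∈B , x∈A) = A⊥B (x∈A , x∈B)
      disjoint {suc zero} {suc zero} i≢j _ = i≢j ≡.refl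
      disjoint {suc zero} {suc (suc _)} _ (_ , ())
      disjoint {suc (suc _)} _ (() , _)
      eventually : ∀ k → partialSum (prob P ∘ S) (k +ⁿ 2) ≈ prob P A + prob P B
      eventually zero = +-congʳ (+-identityˡ _)
      eventually (suc zero) = trans (+-cong (eventually zero) (prob-∅ P)) (+-identityʳ _)
      eventually (suc (suc k)) = trans (+-cong (eventually (suc k)) (tail k)) (+-identityʳ _)
        where
        tail : ∀ k → prob P (S (suc (k +ⁿ 2))) ≈ 0#
        tail zero = prob-∅ P
        tail (suc k) = prob-∅ P

    prob-split : ∀ P A B → prob P A ≈ prob P (A ∩ᵇ B) + prob P (A ∖ᵇ B)
    prob-split P A B = trans
      (prob-cong P A (A ∩ᵇ B ∪ᵇ A ∖ᵇ B) ((λ {x} x∈A → split x∈A em₀) , [ proj₁ , proj₁ ]′))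
      (prob-∪ P (A ∩ᵇ B) (A ∖ᵇ B) λ ((_ , x∈B) , (_ , x∉B)) → x∉B x∈B)
      where
      split : ∀ {x} → x ∈ set A → Dec (x ∈ set B) → x ∈ set (A ∩ᵇ B ∪ᵇ A ∖ᵇ B)
      split x∈A (yes x∈B) = inj₁ (x∈A , x∈B)
      split x∈A (no x∉B)  = inj₂ (x∈A , x∉B)

    prob-mono : ∀ P A B → set A ⊆ set B → prob P A ≤ prob P B
    prob-mono P A B A⊆B = by₀ (nonneg P (B ∖ᵇ A)) (trans
      (+-congʳ (trans (prob-split P B A)
        (+-congʳ (prob-cong P (B ∩ᵇ A) A (proj₂ , λ x∈A → A⊆B x∈A , x∈A)))))
      (solve 2 (λ a b → (a :+ b) :- a := b) refl (prob P A) (prob P (B ∖ᵇ A))))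

    Σ-cong : ∀ P {F G} → (∀ t → F t ≈ G t) → ∀ π → Σ[ P ] F π ≈ Σ[ P ] G π
    Σ-cong P F≈G []            = refl
    Σ-cong P F≈G ((t , A) ∷ π) = +-cong (*-congʳ (F≈G t)) (Σ-cong P F≈G π)

    Σ-mono : ∀ P {F G} π → All (λ (t , _) → F t ≤ G t) π → Σ[ P ] F π ≤ Σ[ P ] G π
    Σ-mono P []            []         = ≤-refl
    Σ-mono P ((t , A) ∷ π) (F≤G ∷ rest) = +-mono-≤ (*-monoʳ-≤ (nonneg P A) F≤G) (Σ-mono P π rest)

    Σ-linear : ∀ P a b F G π → Σ[ P ] (λ t → a * F t + b * G t) π ≈ a * Σ[ P ] F π + b * Σ[ P ] G π
    Σ-linear P a b F G [] = solve 2 (λ a b → con (+ 0) := a :* con (+ 0) :+ b :* con (+ 0)) refl a b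
    Σ-linear P a b F G ((t , A) ∷ π) = trans (+-congˡ (Σ-linear P a b F G π))
      (solve 7 (λ a b f g p x y → (a :* f :+ b :* g) :* p :+ (a :* x :+ b :* y) := a :* (f :* p :+ x) :+ b :* (g :* p :+ y))
        refl a b (F t) (G t) (prob P A) (Σ[ P ] F π) (Σ[ P ] G π))

-- Integrals estimated by sums over a partition.

module Integration (em : ExcludedMiddle (lsuc 0ℓ)) (𝓡 : CompleteOrderedField) where
  open OrderedField em 𝓡
  open Measure em 𝓡

  -- The integral of φ over C. Shrinking C by one piece at a time compares φ with a partition
  -- without forming a common refinement.
  integralOn : ProbabilityMeasure → SimpleFunction → BorelSet → ℝ
  integralOn P []            C = 0#
  integralOn P ((c , B) ∷ φ) C = c * prob P (B ∩ᵇ C) + integralOn P φ C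

  remainder : BorelSet → List (ℝ × BorelSet) → BorelSet
  remainder C []            = C
  remainder C ((_ , A) ∷ π) = remainder (C ∖ᵇ A) π

  -- The value of h at a tag may exceed its value elsewhere on the piece by ε; subtracting ε and
  -- cutting at 0 yields a nonnegative step function below h.
  lowerStep : (ℝ → ℝ) → ℝ → List (ℝ × BorelSet) → SimpleFunction
  lowerStep h ε = map (map₁ (λ t → (h t - ε) ⊔ 0#))

  abstract
    integralOn-cong : ∀ P φ {C D} → All (λ (_ , B) → (set B ∩ set C) ≐ (set B ∩ set D)) φ →
                      integralOn P φ C ≈ integralOn P φ D
    integralOn-cong P [] [] = refl
    integralOn-cong P ((c , B) ∷ φ) (eq ∷ eqs) =
      +-cong (*-congˡ (prob-cong P (B ∩ᵇ _) (B ∩ᵇ _) eq)) (integralOn-cong P φ eqs)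

    integralOn-Univ : ∀ P φ → simpleIntegral P φ ≈ integralOn P φ Univᵇ
    integralOn-Univ P [] = refl
    integralOn-Univ P ((c , B) ∷ φ) = +-cong
      (*-congˡ (prob-cong P B (B ∩ᵇ Univᵇ) ((λ x∈B → x∈B , tt) , proj₁))) (integralOn-Univ P φ)

    integralOn-split : ∀ P φ C A → integralOn P φ C ≈ integralOn P φ (C ∩ᵇ A) + integralOn P φ (C ∖ᵇ A)
    integralOn-split P [] C A = sym (+-identityʳ 0#)
    integralOn-split P ((c , B) ∷ φ) C A = trans
      (+-cong (*-congˡ (trans (prob-split P (B ∩ᵇ C) A)
                (+-cong (prob-cong P (B ∩ᵇ C ∩ᵇ A) (B ∩ᵇ (C ∩ᵇ A)) assoc)
                        (prob-cong P (B ∩ᵇ C ∖ᵇ A) (B ∩ᵇ (C ∖ᵇ A)) assoc))))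
              (integralOn-split P φ C A))
      (solve 5 (λ c x y z w → c :* (x :+ y) :+ (z :+ w) := (c :* x :+ z) :+ (c :* y :+ w)) refl c
        (prob P (B ∩ᵇ (C ∩ᵇ A))) (prob P (B ∩ᵇ (C ∖ᵇ A))) (integralOn P φ (C ∩ᵇ A)) (integralOn P φ (C ∖ᵇ A)))
      where
      assoc : {X Y Z : Pred ℝ 0ℓ} → ((X ∩ Y) ∩ Z) ≐ (X ∩ (Y ∩ Z))
      assoc = (λ ((x , y) , z) → x , (y , z)) , (λ (x , (y , z)) → (x , y) , z)

    integralOn-null : ∀ P φ C → prob P C ≈ 0# → integralOn P φ C ≈ 0#
    integralOn-null P [] C PC≈0 = refl
    integralOn-null P ((c , B) ∷ φ) C PC≈0 = trans
      (+-cong (*-congˡ (antisym (≤-respʳ-≈ PC≈0 (prob-mono P (B ∩ᵇ C) C proj₂)) (nonneg P (B ∩ᵇ C))))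
              (integralOn-null P φ C PC≈0))
      (trans (+-identityʳ _) (zeroʳ c))

    -- Disjointness charges the first term to the part of C inside B and all later terms to the part
    -- outside B, which is where the induction continues.
    integralOn-bound : ∀ P φ {K} C → 0# ≤ K → Disjoint φ → All (λ (c , B) → ∀ {x} → x ∈ set B → x ∈ set C → c ≤ K) φ →
                       integralOn P φ C ≤ K * prob P C
    integralOn-bound P [] C 0≤K _ _ = *-nonneg 0≤K (nonneg P C)
    integralOn-bound P ((c , B) ∷ φ) {K} C 0≤K (B⊥φ ∷ disjoint) (c≤K ∷ φ≤K) =
      ≤-respʳ-≈ (trans (solve 3 (λ k x y → k :* x :+ k :* y := k :* (x :+ y)) refl K _ _)
        (*-congˡ (sym (trans (prob-split P C B) (+-congʳ (prob-cong P (C ∩ᵇ B) (B ∩ᵇ C) ((λ (x , y) → y , x) , (λ (x , y) → y , x))))))))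
      (+-mono-≤ (first em₀)
        (≤-respˡ-≈ (integralOn-cong P φ (All.map (λ {D} → drop {D}) B⊥φ))
          (integralOn-bound P φ (C ∖ᵇ B) 0≤K disjoint (All.map (λ c≤K {_} x∈B x∈C → c≤K x∈B (proj₁ x∈C)) φ≤K))))
      where
      drop : {D : ℝ × BorelSet} → set B ⊥ set (proj₂ D) →
             (set (proj₂ D) ∩ set (C ∖ᵇ B)) ≐ (set (proj₂ D) ∩ set C)
      drop B⊥D = (λ (x∈D , x∈C , _) → x∈D , x∈C) , (λ (x∈D , x∈C) → x∈D , x∈C , λ x∈B → B⊥D (x∈B , x∈D))
      first : Dec (Satisfiable (set (B ∩ᵇ C))) → c * prob P (B ∩ᵇ C) ≤ K * prob P (B ∩ᵇ C)
      first (yes (x , x∈B , x∈C)) = *-monoʳ-≤ (nonneg P (B ∩ᵇ C)) (c≤K x∈B x∈C)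
      -- Without a point of B ∩ C nothing compares c with K, but then both sides vanish.
      first (no empty) = ≤-reflexive (trans (trans (*-congˡ null) (zeroʳ c)) (sym (trans (*-congˡ null) (zeroʳ K))))
        where
        null : prob P (B ∩ᵇ C) ≈ 0#
        null = prob-empty P (B ∩ᵇ C) (λ x∈ → empty (_ , x∈))

    prob-remainder : ∀ P C π → Disjoint π → All (λ (_ , A) → set A ⊆ set C) π →
                     prob P (remainder C π) ≈ prob P C - Σ[ P ] (λ _ → 1#) π
    prob-remainder P C [] [] [] = sym (x-0≈x _)
    prob-remainder P C ((_ , A) ∷ π) (A⊥π ∷ disjoint) (A⊆C ∷ π⊆C) = trans
      (prob-remainder P (C ∖ᵇ A) π disjoint
        (All.zipWith (λ (A⊥B , B⊆C) {_} x∈B → B⊆C x∈B , λ x∈A → A⊥B (x∈A , x∈B)) (A⊥π , π⊆C)))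
      (trans (solve 3 (λ a c s → c :- s := (a :+ c) :- (con (+ 1) :* a :+ s)) refl (prob P A) _ _)
        (+-congʳ (sym (trans (prob-split P C A)
          (+-congʳ (prob-cong P (C ∩ᵇ A) A (proj₂ , λ x∈A → A⊆C x∈A , x∈A)))))))

    -- A coefficient of φ whose set meets the piece A is at most some h x with x in A, hence at most
    -- `h t + ε`. This bounds the integral over C ∩ A; the induction proceeds with the rest of C.
    -- Nonnegativity of `h t + ε` allows C ∩ A to be enlarged to A.
    integralOn-upper : ∀ P φ {h ε} C π → φ SimpleBelow h → (∀ x → 0# ≤ h x) → 0# ≤ ε → Close h ε π →
                       integralOn P φ C ≤ Σ[ P ] (λ t → h t + ε) π + integralOn P φ (remainder C π)
    integralOn-upper P φ C [] _ _ _ [] = ≤-reflexive (sym (+-identityˡ _))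
    integralOn-upper P φ {h} {ε} C ((t , A) ∷ π) below@(disjoint , φ≤h) 0≤h 0≤ε (close ∷ closes) =
      ≤-respˡ-≈ (sym (integralOn-split P φ C A))
      (≤-trans (+-mono-≤
          (≤-trans (integralOn-bound P φ (C ∩ᵇ A) 0≤K disjoint
                     (All.map (λ (_ , c≤h) {_} x∈B (_ , x∈A) → ≤-trans (c≤h x∈B) (proj₁ (close x∈A))) φ≤h))
                   (*-monoˡ-≤ 0≤K (prob-mono P (C ∩ᵇ A) A proj₂)))
          (integralOn-upper P φ (C ∖ᵇ A) π below 0≤h 0≤ε closes))
        (≤-reflexive (solve 3 (λ x y z → x :+ (y :+ z) := (x :+ y) :+ z) refl _ _ _)))
      where
      0≤K : 0# ≤ h t + ε
      0≤K = 0≤-+ (0≤h t) 0≤ε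

    simpleIntegral-upper : ∀ P φ {h ε} π → IsPartition P π → φ SimpleBelow h → (∀ x → 0# ≤ h x) → 0# ≤ ε →
                           Close h ε π → simpleIntegral P φ ≤ Σ[ P ] h π + ε
    simpleIntegral-upper P φ {h} {ε} π (disjoint , mass) below 0≤h 0≤ε close =
      ≤-respˡ-≈ (sym (integralOn-Univ P φ))
      (≤-respʳ-≈ (trans (+-cong shift (integralOn-null P φ (remainder Univᵇ π) null)) (+-identityʳ _))
        (integralOn-upper P φ Univᵇ π below 0≤h 0≤ε close))
      where
      -- The pieces already have total mass 1, so whatever φ does off them contributes nothing.
      null : prob P (remainder Univᵇ π) ≈ 0#
      null = trans (prob-remainder P Univᵇ π disjoint (All.universal (λ _ {_} _ → tt) π))
        (trans (+-cong (ProbabilityMeasure.total P Univᵇ (id , id)) (-‿cong mass)) (-‿inverseʳ 1#))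
      shift : Σ[ P ] (λ t → h t + ε) π ≈ Σ[ P ] h π + ε
      shift = trans (Σ-cong P (λ t → solve 2 (λ h ε → h :+ ε := con (+ 1) :* h :+ ε :* con (+ 1)) refl (h t) ε) π)
        (trans (Σ-linear P 1# ε h (λ _ → 1#) π)
          (+-cong (*-identityˡ _) (trans (*-congˡ mass) (*-identityʳ ε))))

    simpleIntegral-map : ∀ P F π → simpleIntegral P (map (map₁ F) π) ≈ Σ[ P ] F π
    simpleIntegral-map P F []      = refl
    simpleIntegral-map P F (_ ∷ π) = +-congˡ (simpleIntegral-map P F π)

    lowerStep-below : ∀ {h ε} π → Disjoint π → (∀ x → 0# ≤ h x) → Close h ε π → lowerStep h ε π SimpleBelow h
    lowerStep-below {h} {ε} π disjoint 0≤h close = AllPairs.map⁺ disjoint , All.map⁺ (All.map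
      (λ {(t , _)} close-t → y≤x⊔y (h t - ε) 0# , λ {x} x∈A → ⊔-lub
        (by₁ (proj₂ (close-t x∈A)) (solve 3 (λ x t ε → x :- (t :- ε) := (x :+ ε) :- t) refl (h x) (h t) ε))
        (0≤h x)) close)

    simpleIntegral-lower : ∀ P {h ε} π → IsPartition P π → Σ[ P ] h π - ε ≤ simpleIntegral P (lowerStep h ε π)
    simpleIntegral-lower P {h} {ε} π (_ , mass) =
      ≤-respʳ-≈ (sym (simpleIntegral-map P _ π))
      (≤-respˡ-≈ shift (Σ-mono P π (All.universal (λ (t , _) → x≤x⊔y (h t - ε) 0#) π)))
      where
      shift : Σ[ P ] (λ t → h t - ε) π ≈ Σ[ P ] h π - ε
      shift = trans (Σ-cong P (λ t → solve 2 (λ h ε → h :- ε := con (+ 1) :* h :+ (:- ε) :* con (+ 1)) refl (h t) ε) π)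
        (trans (Σ-linear P 1# (- ε) h (λ _ → 1#) π)
          (+-cong (*-identityˡ _) (trans (*-congˡ mass) (*-identityʳ (- ε)))))

    module _ (P : ProbabilityMeasure) {h ε} (π : List (ℝ × BorelSet)) (partition : IsPartition P π)
             (0≤h : ∀ x → 0# ≤ h x) (0≤ε : 0# ≤ ε) (close : Close h ε π) where

      private
        Sums : Pred ℝ (lsuc 0ℓ)
        Sums s = ∃[ φ ] (φ SimpleBelow h × s ≈ simpleIntegral P φ)

        upper : IsUpperBound Sums (Σ[ P ] h π + ε)
        upper (φ , below , s≈) = ≤-respˡ-≈ (sym s≈) (simpleIntegral-upper P φ π partition below 0≤h 0≤ε close)

      -- The upper sum of a single close partition bounds all lower sums at once, so one ε is enough
      -- for finiteness.
      integral⁺-exists : ∃ (IsIntegral⁺ P h)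
      integral⁺-exists = completeness Sums (0# , [] , ([] , []) , refl) (_ , λ {s} → upper {s})

      integral⁺-bounds : ∀ {a} → IsIntegral⁺ P h a → a ≤ Σ[ P ] h π + ε × Σ[ P ] h π ≤ a + ε
      integral⁺-bounds {a} (ub , least) = least (λ {s} → upper {s}) , by₁
        (≤-trans (simpleIntegral-lower P {h} {ε} π partition)
          (ub (lowerStep h ε π , lowerStep-below π (proj₁ partition) 0≤h close , refl)))
        (solve 3 (λ a s ε → (a :+ ε) :- s := a :- (s :- ε)) refl a (Σ[ P ] h π) ε)

    ⊔0-close : ∀ {f ε} π → 0# ≤ ε → Close f ε π → Close (λ x → f x ⊔ 0#) ε π
    ⊔0-close {f} {ε} π 0≤ε = All.map λ close {_} x∈A → lip (proj₁ (close x∈A)) , lip (proj₂ (close x∈A))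
      where
      lip : ∀ {x y} → x ≤ y + ε → x ⊔ 0# ≤ (y ⊔ 0#) + ε
      lip {x} {y} x≤y+ε = ⊔-lub (≤-trans x≤y+ε (+-monoˡ-≤ ε (x≤x⊔y y 0#))) (0≤-+ (y≤x⊔y y 0#) 0≤ε)

    neg-close : ∀ {f ε} π → Close f ε π → Close (λ x → - f x) ε π
    neg-close {f} {ε} π = All.map λ close {_} x∈A → flip (proj₂ (close x∈A)) , flip (proj₁ (close x∈A))
      where
      flip : ∀ {x y} → x ≤ y + ε → - y ≤ - x + ε
      flip {x} {y} x≤ = by₁ x≤ (solve 3 (λ x y ε → (:- x :+ ε) :- (:- y) := (y :+ ε) :- x) refl x y ε)

    module _ (P : ProbabilityMeasure) {f ε} (π : List (ℝ × BorelSet)) (partition : IsPartition P π)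
             (0≤ε : 0# ≤ ε) (close : Close f ε π) where
      private
        f⁺ f⁻ : ℝ → ℝ
        f⁺ x = f x ⊔ 0#
        f⁻ x = (- f x) ⊔ 0#

        close⁺ : Close f⁺ ε π
        close⁺ = ⊔0-close π 0≤ε close
        close⁻ : Close f⁻ ε π
        close⁻ = ⊔0-close π 0≤ε (neg-close π close)

        0≤f⁺ : ∀ x → 0# ≤ f⁺ x
        0≤f⁺ x = y≤x⊔y (f x) 0#
        0≤f⁻ : ∀ x → 0# ≤ f⁻ x
        0≤f⁻ x = y≤x⊔y (- f x) 0#

      expectation-exists : Measurable f → Satisfiable (𝔼 P f)
      expectation-exists measurable =
        let a , ∫f⁺ = integral⁺-exists P {f⁺} π partition 0≤f⁺ 0≤ε close⁺
            b , ∫f⁻ = integral⁺-exists P {f⁻} π partition 0≤f⁻ 0≤ε close⁻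
        in a - b , measurable , a , b , ∫f⁺ , ∫f⁻ , refl

      -- One ε is the error of the positive part, the other that of the negative part.
      expectation-bounds : ∀ {v} → v ∈ 𝔼 P f → v ≤ Σ[ P ] f π + (ε + ε) × Σ[ P ] f π ≤ v + (ε + ε)
      expectation-bounds {v} (_ , a , b , ∫f⁺ , ∫f⁻ , v≈a-b) =
        let a≤ , ≤a = integral⁺-bounds P {f⁺} π partition 0≤f⁺ 0≤ε close⁺ ∫f⁺
            b≤ , ≤b = integral⁺-bounds P {f⁻} π partition 0≤f⁻ 0≤ε close⁻ ∫f⁻
        in ≤-respˡ-≈ (sym v≈a-b) (≤-respʳ-≈ (+-congʳ (sym Σf)) (by₂ a≤ ≤b
             (solve 5 (λ a b s t ε → ((s :- t) :+ (ε :+ ε)) :- (a :- b) := ((s :+ ε) :- a) :+ ((b :+ ε) :- t)) refl a b _ _ ε)))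
         , ≤-respˡ-≈ (sym Σf) (≤-respʳ-≈ (+-congʳ (sym v≈a-b)) (by₂ ≤a b≤
             (solve 5 (λ a b s t ε → ((a :- b) :+ (ε :+ ε)) :- (s :- t) := ((a :+ ε) :- s) :+ ((t :+ ε) :- b)) refl a b _ _ ε)))
        where
        Σf : Σ[ P ] f π ≈ Σ[ P ] f⁺ π - Σ[ P ] f⁻ π
        Σf = trans (Σ-cong P (λ t → trans (sym (pos-neg-part (f t)))
               (solve 2 (λ x y → x :- y := con (+ 1) :* x :+ (:- con (+ 1)) :* y) refl (f⁺ t) (f⁻ t))) π)
          (trans (Σ-linear P 1# (- 1#) f⁺ f⁻ π)
            (solve 2 (λ x y → con (+ 1) :* x :+ (:- con (+ 1)) :* y := x :- y) refl (Σ[ P ] f⁺ π) (Σ[ P ] f⁻ π)))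

-- Continuous functions and covers of small oscillation.

module Continuity (em : ExcludedMiddle (lsuc 0ℓ)) (𝓡 : CompleteOrderedField) where
  open OrderedField em 𝓡
  open Measure em 𝓡

  -- Preimages commute with complements and countable unions, so induction on the generation of
  -- `Borel` leaves only the open sets to continuity.
  continuous⇒measurable : ∀ {f} → Continuous f → Measurable f
  continuous⇒measurable cont (isOpen A-open) = isOpen λ {x} fx∈A →
    let ε , 0<ε , ball = A-open fx∈A
        δ , 0<δ , close = cont x 0<ε
    in δ , 0<δ , λ y ∣y-x∣<δ → ball _ (close y ∣y-x∣<δ)
  continuous⇒measurable cont (complement B) = complement (continuous⇒measurable cont B)
  continuous⇒measurable cont (union B) = union (λ n → continuous⇒measurable cont (B n))
  continuous⇒measurable cont (resp-≐ (A⊆B , B⊆A) B) = resp-≐ ((λ x∈ → A⊆B x∈) , (λ x∈ → B⊆A x∈)) (continuous⇒measurable cont B)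

  abstract
    ∣x-y∣≈0 : ∀ {x y} → x ≈ y → ∣ x - y ∣ ≈ 0#
    ∣x-y∣≈0 {x} {y} x≈y = antisym (⊔-lub (≤-reflexive x-y≈0) (≤-reflexive (trans (-‿cong x-y≈0) -0≈0))) (0≤∣x∣ (x - y))
      where
      x-y≈0 : x - y ≈ 0#
      x-y≈0 = trans (+-congʳ x≈y) (-‿inverseʳ y)

    ∣x-y∣≈0⇒x≈y : ∀ {x y} → ∣ x - y ∣ ≈ 0# → x ≈ y
    ∣x-y∣≈0⇒x≈y {x} {y} eq = squeeze λ 0<ε → ≤-<-trans (≤-reflexive eq) 0<ε

    continuous⇒cong : ∀ {f} → Continuous f → ∀ {x y} → x ≈ y → f x ≈ f y
    continuous⇒cong {f} cont {x} {y} x≈y = squeeze λ 0<ε →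
      let δ , 0<δ , close = cont y 0<ε in
      close x (≤-<-trans (≤-reflexive (∣x-y∣≈0 x≈y)) 0<δ)

    ≉-open : ∀ r → IsOpen (_≉ r)
    ≉-open r {x} x≉r = ∣ r - x ∣ , (0≤∣x∣ (r - x) , λ eq → x≉r (sym (∣x-y∣≈0⇒x≈y (sym eq))))
      , λ y ∣y-x∣<∣r-x∣ y≈r → proj₂ ∣y-x∣<∣r-x∣
          (⊔-cong (+-congʳ y≈r) (-‿cong (+-congʳ y≈r)))

    singleton-borel : ∀ r → Borel (_≈ r)
    singleton-borel r = resp-≐ (decidable-stable em₀ , λ x≈r x≉r → x≉r x≈r) (complement (isOpen (≉-open r)))

    continuous-∘affine : ∀ {g} S → 0# < S → Continuous g → Continuous (λ x → g (S * (1# + x)))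
    continuous-∘affine {g} S 0<S cont x {ε} 0<ε =
      let δ , 0<δ , close = cont (S * (1# + x)) 0<ε
          S⁻¹ , 0<S⁻¹ , SS⁻¹≈1 = inverse-pos 0<S
          scale : ∀ {z w} → S * z ≈ w → z < δ * S⁻¹ → w < δ
          scale {z} {w} Sz≈w z<δ/S = by₀< (*-pos 0<S (<⇒0<- z<δ/S)) (trans
            (+-cong (trans (sym (*-identityʳ δ)) (*-congˡ (sym SS⁻¹≈1))) (-‿cong (sym Sz≈w)))
            (solve 4 (λ δ s z i → δ :* (s :* i) :- s :* z := s :* (δ :* i :- z)) refl δ S z S⁻¹))
      -- The affine map stretches distances by S, so the radius is δ / S.
      in δ * S⁻¹ , *-pos 0<δ 0<S⁻¹ , λ y ∣y-x∣<δ/S → close (S * (1# + y)) (⊔-lub-<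
           (scale (solve 3 (λ s x y → s :* (y :- x) := s :* (con (+ 1) :+ y) :- s :* (con (+ 1) :+ x)) refl S x y)
             (≤-<-trans (x≤∣x∣ (y - x)) ∣y-x∣<δ/S))
           (scale (solve 3 (λ s x y → s :* (:- (y :- x)) := :- (s :* (con (+ 1) :+ y) :- s :* (con (+ 1) :+ x))) refl S x y)
             (≤-<-trans (-x≤∣x∣ (y - x)) ∣y-x∣<δ/S)))

  ｛_｝ᵇ : ℝ → BorelSet
  ｛ r ｝ᵇ = (_≈ r) ,ᵇ singleton-borel r

  -- Tags lie in C so that inequalities known on 𝒰 apply to them. `close-id` makes the pieces short,
  -- so the same pieces also approximate the mean.
  record Cover (f : ℝ → ℝ) (ε : ℝ) (C : BorelSet) : Set₁ where
    field
      pieces   : List (ℝ × BorelSet)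
      disjoint : Disjoint pieces
      inside   : All (λ (t , A) → t ∈ set C × set A ⊆ set C) pieces
      covers   : ∀ {x} → x ∈ set C → Any (λ (_ , A) → x ∈ set A) pieces
      close    : Close f ε pieces
      close-id : Close id ε pieces

  open Cover public

  cover-resp : ∀ {f ε C D} → set C ≐ set D → Cover f ε C → Cover f ε D
  cover-resp (C⊆D , D⊆C) κ = record
    { pieces   = pieces κ
    ; disjoint = disjoint κ
    ; inside   = All.map (λ (t∈C , A⊆C) → C⊆D t∈C , (λ {_} x∈A → C⊆D (A⊆C x∈A))) (inside κ)
    ; covers   = λ x∈D → covers κ (D⊆C x∈D)
    ; close    = close κ
    ; close-id = close-id κ
    }

  cover-∪ : ∀ {f ε C D} → set C ⊥ set D → Cover f ε C → Cover f ε D → Cover f ε (C ∪ᵇ D)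
  cover-∪ C⊥D κ μ = record
    { pieces   = pieces κ ++ pieces μ
    ; disjoint = AllPairs.++⁺ (disjoint κ) (disjoint μ)
        (All.map (λ (_ , A⊆C) → All.map (λ (_ , B⊆D) {_} (x∈A , x∈B) → C⊥D (A⊆C x∈A , B⊆D x∈B)) (inside μ)) (inside κ))
    ; inside   = All.++⁺ (All.map (λ (t∈C , A⊆C) → inj₁ t∈C , (λ {_} x∈A → inj₁ (A⊆C x∈A))) (inside κ))
                         (All.map (λ (t∈D , A⊆D) → inj₂ t∈D , (λ {_} x∈A → inj₂ (A⊆D x∈A))) (inside μ))
    ; covers   = [ (λ x∈C → Any.++⁺ˡ (covers κ x∈C)) , (λ x∈D → Any.++⁺ʳ (pieces κ) (covers μ x∈D)) ]′
    ; close    = All.++⁺ (close κ) (close μ)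
    ; close-id = All.++⁺ (close-id κ) (close-id μ)
    }

  cover-small : ∀ {f ε} C → (∀ {x y} → x ∈ set C → y ∈ set C → f x ≤ f y + ε × x ≤ y + ε) → Cover f ε C
  cover-small {f} {ε} C osc = go em₀
    where
    go : Dec (Satisfiable (set C)) → Cover f ε C
    go (yes (t , t∈C)) = record
      { pieces   = (t , C) ∷ []
      ; disjoint = [] ∷ []
      ; inside   = (t∈C , id) ∷ []
      ; covers   = here
      ; close    = (λ x∈C → proj₁ (osc x∈C t∈C) , proj₁ (osc t∈C x∈C)) ∷ []
      ; close-id = (λ x∈C → proj₂ (osc x∈C t∈C) , proj₂ (osc t∈C x∈C)) ∷ []
      }
    -- A piece must have its tag in C, so an empty C is covered by no pieces at all.
    go (no empty) = record
      { pieces   = []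
      ; disjoint = []
      ; inside   = []
      ; covers   = λ x∈C → ⊥-elim (empty (_ , x∈C))
      ; close    = []
      ; close-id = []
      }

  abstract
    -- Removing `Ioi u` leaves C ∩ (-∞, u]. Going from u to v adds only C ∩ (u, v], on which the
    -- oscillation is at most ε, so one more piece suffices.
    cover-extend : ∀ {f ε} C {u v} → u ≤ v → Cover f ε (C ∖ᵇ Ioi u) →
                   (∀ {x y} → u < x → x ≤ v → u < y → y ≤ v → f x ≤ f y + ε × x ≤ y + ε) →
                   Cover f ε (C ∖ᵇ Ioi v)
    cover-extend C {u} {v} u≤v κ osc = cover-resp
      ([ (λ (x∈C , u≮x) → x∈C , λ v<x → u≮x (≤-<-trans u≤v v<x)) , (λ ((x∈C , _) , v≮x) → x∈C , v≮x) ]′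
      , λ (x∈C , v≮x) → split x∈C v≮x em₀)
      (cover-∪ {C = C ∖ᵇ Ioi u} {D = C ∩ᵇ Ioi u ∖ᵇ Ioi v} (λ ((_ , u≮x) , ((_ , u<x) , _)) → u≮x u<x) κ
        (cover-small (C ∩ᵇ Ioi u ∖ᵇ Ioi v) λ ((_ , u<x) , v≮x) ((_ , u<y) , v≮y) → osc u<x (≮⇒≥ v≮x) u<y (≮⇒≥ v≮y)))
      where
      ≮⇒≥ : ∀ {x y} → ¬ x < y → y ≤ x
      ≮⇒≥ {x} {y} x≮y = [ id , (λ x<y → ⊥-elim (x≮y x<y)) ]′ (≤-<-connex y x)
      split : ∀ {x} → x ∈ set C → ¬ v < x → Dec (u < x) → x ∈ set (C ∖ᵇ Ioi u ∪ᵇ C ∩ᵇ Ioi u ∖ᵇ Ioi v)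
      split x∈C v≮x (yes u<x) = inj₂ ((x∈C , u<x) , v≮x)
      split x∈C v≮x (no u≮x)  = inj₁ (x∈C , u≮x)

    oscillation : ∀ {F : ℝ → ℝ} {c h ε x y} → h + h ≈ ε → ∣ F x - F c ∣ < h → ∣ F y - F c ∣ < h → F x ≤ F y + ε
    oscillation {F} {c} {h} {ε} {x} {y} h+h≈ε x-close y-close = ≤-respʳ-≈ (+-congˡ h+h≈ε)
      (by₂ (≤-trans (x≤∣x∣ (F x - F c)) (<⇒≤ x-close)) (≤-trans (-x≤∣x∣ (F y - F c)) (<⇒≤ y-close))
        (solve 4 (λ x y c h → (y :+ (h :+ h)) :- x := (h :- (x :- c)) :+ (h :- (:- (y :- c)))) refl (F x) (F y) (F c) h))

    smaller : ∀ {a b} → 0# < a → 0# < b → ∃[ d ] (0# < d × d ≤ a × d ≤ b)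
    smaller {a} {b} 0<a 0<b =
      [ (λ a≤b → a , 0<a , ≤-refl , a≤b) , (λ b<a → b , 0<b , <⇒≤ b<a , ≤-refl) ]′ (≤-<-connex a b)

    -- The length k is fixed before u and v. A cover reaching any u just below c can therefore be
    -- carried to c + k, strictly beyond c.
    extendable : ∀ {f} → Continuous f → ∀ {ε} → 0# < ε → ∀ C c → ∃[ k ] (0# < k ×
                 (∀ {u v} → c - k < u → u ≤ v → v ≤ c + k → Cover f ε (C ∖ᵇ Ioi u) → Cover f ε (C ∖ᵇ Ioi v)))
    extendable {f} cont {ε} 0<ε C c =
      -- Two points are compared through c, at a cost of h = ε / 2 each, both for f and for the
      -- identity; hence δ is bounded by h as well.
      let _ , 0<h , h+h≈ε = halve 0<ε
          _ , 0<δ₀ , f-close = cont c 0<h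
          _ , 0<δ , δ≤δ₀ , δ≤h = smaller 0<δ₀ 0<h
          -- Points of (u, v] are within k of c; taking half of δ makes that distance strictly less
          -- than δ.
          k , 0<k , k+k≈δ = halve 0<δ
      in k , 0<k , extend h+h≈ε f-close δ≤δ₀ δ≤h 0<k k+k≈δ
      where
      extend : ∀ {h δ₀ δ k} → h + h ≈ ε → (∀ y → ∣ y - c ∣ < δ₀ → ∣ f y - f c ∣ < h) → δ ≤ δ₀ → δ ≤ h →
               0# < k → k + k ≈ δ →
               ∀ {u v} → c - k < u → u ≤ v → v ≤ c + k → Cover f ε (C ∖ᵇ Ioi u) → Cover f ε (C ∖ᵇ Ioi v)
      extend {h} {δ₀} {δ} {k} h+h≈ε f-close δ≤δ₀ δ≤h 0<k k+k≈δ {u} {v} c-k<u u≤v v≤c+k κ =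
        cover-extend C u≤v κ λ {x} {y} u<x x≤v u<y y≤v →
            oscillation {f} h+h≈ε (f-close x (<-≤-trans (near u<x x≤v) δ≤δ₀)) (f-close y (<-≤-trans (near u<y y≤v) δ≤δ₀))
          , oscillation {id} h+h≈ε (<-≤-trans (near u<x x≤v) δ≤h) (<-≤-trans (near u<y y≤v) δ≤h)
        where
        near : ∀ {x} → u < x → x ≤ v → ∣ x - c ∣ < δ
        near {x} u<x x≤v = <-respʳ k+k≈δ (⊔-lub-<
          (by₂< (≤-trans x≤v v≤c+k) 0<k
            (solve 3 (λ x c k → (k :+ k) :- (x :- c) := ((c :+ k) :- x) :+ (k :- con (+ 0))) refl x c k))
          (by₂< (0≤-+ (<⇒≤ 0<k) (≤⇒0≤- (<⇒≤ c-k<u))) u<x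
            (solve 4 (λ x c k u → (k :+ k) :- (:- (x :- c)) := ((k :+ (u :- (c :- k))) :- con (+ 0)) :+ (x :- u)) refl x c k u)))

    sup-approached : ∀ {A : Pred ℝ (lsuc 0ℓ)} {c k} → IsSup A c → 0# < k → ∃[ u ] (u ∈ A × c - k < u)
    sup-approached {A} {c} {k} (_ , least) 0<k = go em
      where
      go : Dec (∃[ u ] (u ∈ A × c - k < u)) → ∃[ u ] (u ∈ A × c - k < u)
      go (yes found) = found
      go (no none) = ⊥-elim (<⇒≱ 0<k (by₁
        (least λ {x} x∈A → [ id , (λ c-k<x → ⊥-elim (none (x , x∈A , c-k<x))) ]′ (≤-<-connex x (c - k)))
        (solve 2 (λ c k → con (+ 0) :- k := (c :- k) :- c) refl c k)))

    -- The supremum of the u ≤ M for which C ∩ (−∞, u] has a cover is M, since covers extend past it.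
    cover-exists : ∀ {f} → Continuous f → ∀ {ε} → 0# < ε → (C : BorelSet) → Bounded (set C) → Cover f ε C
    cover-exists {f} cont {ε} 0<ε C (M , C≤M) =
      cover-resp (proj₁ , λ {x} x∈C → x∈C , λ M<x → <⇒≱ M<x (≤-trans (x≤∣x∣ x) (C≤M x∈C)))
        (top (completeness Good (L , L∈Good) (M , proj₂)))
      where
      L : ℝ
      -- The 1 puts L strictly below C, so that the initial cover is empty; the absolute value
      -- ensures L ≤ M even for a negative M, which can occur when C is empty.
      L = - (∣ M ∣ + 1#)

      Good : Pred ℝ (lsuc 0ℓ)
      Good u = Cover f ε (C ∖ᵇ Ioi u) × u ≤ M

      L<x : ∀ {x} → x ∈ set C → L < x
      L<x {x} x∈C = by₂< (≤-trans (-x≤∣x∣ x) (≤-trans (C≤M x∈C) (x≤∣x∣ M))) 0<1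
        (solve 2 (λ x m → x :- (:- (m :+ con (+ 1))) := (m :- (:- x)) :+ (con (+ 1) :- con (+ 0))) refl x ∣ M ∣)

      L∈Good : L ∈ Good
      L∈Good = cover-small (C ∖ᵇ Ioi L) (λ (x∈C , L≮x) → ⊥-elim (L≮x (L<x x∈C)))
             , by₂ (-x≤∣x∣ M) (<⇒≤ 0<1)
                 (solve 2 (λ m a → m :- (:- (a :+ con (+ 1))) := (a :- (:- m)) :+ (con (+ 1) :- con (+ 0))) refl M ∣ M ∣)

      top : ∃ (IsSup Good) → Cover f ε (C ∖ᵇ Ioi M)
      top (c , is-sup) =
        let k , 0<k , extend = extendable cont 0<ε C c
            u , u∈Good , c-k<u = sup-approached is-sup 0<k
        in past 0<k extend u∈Good c-k<u
        where
        past : ∀ {k u} → 0# < k →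
               (∀ {u v} → c - k < u → u ≤ v → v ≤ c + k → Cover f ε (C ∖ᵇ Ioi u) → Cover f ε (C ∖ᵇ Ioi v)) →
               u ∈ Good → c - k < u → Cover f ε (C ∖ᵇ Ioi M)
        past {k} {u} 0<k extend u∈Good@(κ , u≤M) c-k<u =
          [ (λ c+k≤M → ⊥-elim (impossible c+k≤M)) , (λ M<c+k → extend c-k<u u≤M (<⇒≤ M<c+k) κ) ]′ (≤-<-connex (c + k) M)
          where
          u≤c+k : u ≤ c + k
          u≤c+k = ≤-trans (proj₁ is-sup {u} u∈Good)
            (by₁ (<⇒≤ 0<k) (solve 2 (λ c k → (c :+ k) :- c := k :- con (+ 0)) refl c k))
          impossible : ¬ c + k ≤ M
          impossible c+k≤M = <⇒≱ 0<k (by₁ (proj₁ is-sup {c + k} (extend c-k<u u≤c+k ≤-refl κ , c+k≤M))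
            (solve 2 (λ c k → con (+ 0) :- k := c :- (c :+ k)) refl c k))

    remainder-⊆ : ∀ C π {x} → x ∈ set (Integration.remainder em 𝓡 C π) → x ∈ set C × All (λ (_ , A) → x ∉ set A) π
    remainder-⊆ C [] x∈C = x∈C , []
    remainder-⊆ C ((_ , A) ∷ π) x∈ =
      let (x∈C , x∉A) , x∉π = remainder-⊆ (C ∖ᵇ A) π x∈ in x∈C , x∉A ∷ x∉π

    -- No point of C escapes the pieces, so the remainder, of mass P C minus the sum, is null.
    cover-mass : ∀ {f ε C} (κ : Cover f ε C) P → prob P C ≈ 1# → IsPartition P (pieces κ)
    cover-mass {C = C} κ P PC≈1 = disjoint κ , trans
      (solve 2 (λ c s → s := c :- (c :- s)) refl (prob P C) (Σ[ P ] (λ _ → 1#) (pieces κ)))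
      (trans (+-cong PC≈1 (-‿cong (trans (sym (Integration.prob-remainder em 𝓡 P C (pieces κ) (disjoint κ) (All.map proj₂ (inside κ))))
        (prob-empty P _ λ x∈ → let x∈C , x∉π = remainder-⊆ C (pieces κ) x∈ in All.All¬⇒¬Any x∉π (covers κ x∈C)))))
        (x-0≈x 1#))

    -- On each of the finitely many pieces f is at most `f t + ε`; this takes the place of a
    -- compactness argument.
    cover-bounded : ∀ {f ε C} → Cover f ε C → ∃[ B ] (∀ {x} → x ∈ set C → f x ≤ B)
    cover-bounded {f} {ε} κ =
      let B , f≤B = go (pieces κ) (close κ) in B , λ x∈C → f≤B (covers κ x∈C)
      where
      go : ∀ π → Close f ε π → ∃[ B ] (∀ {x} → Any (λ (_ , A) → x ∈ set A) π → f x ≤ B)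
      go [] [] = 0# , λ ()
      go ((t , A) ∷ π) (close-t ∷ rest) =
        let B , f≤B = go π rest in
        (f t + ε) ⊔ B , λ { (here x∈A) → ≤-trans (proj₁ (close-t x∈A)) (x≤x⊔y (f t + ε) B)
                          ; (there x∈π) → ≤-trans (f≤B x∈π) (y≤x⊔y (f t + ε) B) }

-- Two-point laws and their expectations.

module TwoPoint (em : ExcludedMiddle (lsuc 0ℓ)) (𝓡 : CompleteOrderedField) where
  open OrderedField em 𝓡
  open Measure em 𝓡
  open Integration em 𝓡
  open Continuity em 𝓡

  abstract
    -- Excluded middle turns membership into a number, so `indicator (r ∈ set A)` is the Dirac mass
    -- at r evaluated at A.
    indicator : Set → ℝ
    indicator X = go em₀
      where
      go : Dec X → ℝ
      go (yes _) = 1#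
      go (no _)  = 0#

    indicator-yes : ∀ {X} → X → indicator X ≈ 1#
    indicator-yes {X} x with em₀ {X}
    ... | yes _ = refl
    ... | no ¬x = ⊥-elim (¬x x)

    indicator-no : ∀ {X} → ¬ X → indicator X ≈ 0#
    indicator-no {X} ¬x with em₀ {X}
    ... | yes x = ⊥-elim (¬x x)
    ... | no _ = refl

    indicator-cong : ∀ {X Y} → (X → Y) → (Y → X) → indicator X ≈ indicator Y
    indicator-cong {X} {Y} f g with em₀ {X}
    ... | yes x = sym (indicator-yes (f x))
    ... | no ¬x = sym (indicator-no (λ y → ¬x (g y)))

    0≤indicator : ∀ X → 0# ≤ indicator X
    0≤indicator X with em₀ {X}
    ... | yes _ = <⇒≤ 0<1
    ... | no _ = ≤-refl

  abstract
    partialSum-zero : ∀ {a} n → (∀ j → suc j ≤ⁿ n → a j ≈ 0#) → partialSum a n ≈ 0#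
    partialSum-zero zero    a≈0 = refl
    partialSum-zero (suc n) a≈0 = trans
      (+-cong (partialSum-zero n (λ j j<n → a≈0 j (ℕ.m≤n⇒m≤1+n j<n))) (a≈0 n ℕ.≤-refl)) (+-identityʳ 0#)

    partialSum-single : ∀ {a} i → (∀ j → j ≢ i → a j ≈ 0#) → ∀ n → suc i ≤ⁿ n → partialSum a n ≈ a i
    partialSum-single i a≈0 (suc n) (s≤s i≤n) with n ℕ.≟ i
    ... | yes ≡.refl = trans (+-congʳ (partialSum-zero n λ j j<n → a≈0 j (ℕ.<⇒≢ j<n))) (+-identityˡ _)
    ... | no n≢i = trans (+-cong (partialSum-single i a≈0 n (ℕ.≤∧≢⇒< i≤n (n≢i ∘ ≡.sym))) (a≈0 n n≢i)) (+-identityʳ _)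

    partialSum-linear : ∀ q p {a b} n → partialSum (λ i → q * a i + p * b i) n ≈ q * partialSum a n + p * partialSum b n
    partialSum-linear q p zero = solve 2 (λ q p → con (+ 0) := q :* con (+ 0) :+ p :* con (+ 0)) refl q p
    partialSum-linear q p {a} {b} (suc n) = trans (+-congʳ (partialSum-linear q p n))
      (solve 6 (λ q p x y a b → (q :* x :+ p :* y) :+ (q :* a :+ p :* b) := q :* (x :+ a) :+ p :* (y :+ b)) refl
        q p (partialSum a n) (partialSum b n) (a n) (b n))

    -- At most one of the disjoint sets contains r, so the partial sums become exactly constant and
    -- no limit argument is required.
    indicator-sum : ∀ r (A : ℕ → Pred ℝ 0ℓ) → (∀ {i j} → i ≢ j → A i ⊥ A j) →
                    ∃[ N ] (∀ n → N ≤ⁿ n → partialSum (λ i → indicator (r ∈ A i)) n ≈ indicator (r ∈ ⋃ ℕ A))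
    indicator-sum r A disjoint = go em₀
      where
      go : Dec (r ∈ ⋃ ℕ A) → ∃[ N ] (∀ n → N ≤ⁿ n → partialSum (λ i → indicator (r ∈ A i)) n ≈ indicator (r ∈ ⋃ ℕ A))
      -- `partialSum a n` uses the indices below n, so term i is included from n = i + 1 on.
      go (yes (i , r∈Ai)) = suc i , λ n i<n → trans
        (partialSum-single i (λ j j≢i → indicator-no λ r∈Aj → disjoint j≢i (r∈Aj , r∈Ai)) n i<n)
        (indicator-cong (i ,_) (λ _ → r∈Ai))
      go (no r∉⋃A) = zero , λ n _ → trans
        (partialSum-zero n λ j _ → indicator-no λ r∈Aj → r∉⋃A (j , r∈Aj))
        (sym (indicator-no r∉⋃A))

  module _ {q p} (0≤q : 0# ≤ q) (0≤p : 0# ≤ p) (q+p≈1 : q + p ≈ 1#) (r s : ℝ) where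

    abstract
      indicators-sum : ∀ {X Y} → X → Y → q * indicator X + p * indicator Y ≈ 1#
      indicators-sum x y = trans
        (+-cong (trans (*-congˡ (indicator-yes x)) (*-identityʳ q)) (trans (*-congˡ (indicator-yes y)) (*-identityʳ p)))
        q+p≈1

    twoPoint : ProbabilityMeasure
    twoPoint = record
      { prob       = λ A → q * indicator (r ∈ set A) + p * indicator (s ∈ set A)
      ; prob-cong  = λ A B (A⊆B , B⊆A) →
          +-cong (*-congˡ (indicator-cong A⊆B B⊆A)) (*-congˡ (indicator-cong A⊆B B⊆A))
      ; nonneg     = λ A → 0≤-+ (*-nonneg 0≤q (0≤indicator (r ∈ set A))) (*-nonneg 0≤p (0≤indicator (s ∈ set A)))
      ; σ-additive = λ A disjoint {ε} 0<ε →
          let M , r-sum = indicator-sum r (set ∘ A) disjoint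
              N , s-sum = indicator-sum s (set ∘ A) disjoint
          in M ⊔ⁿ N , λ n M⊔N≤n → ≤-<-trans
               (≤-reflexive (∣x-y∣≈0 (trans (partialSum-linear q p n)
                 (+-cong (*-congˡ (r-sum n (ℕ.≤-trans (ℕ.m≤m⊔n M N) M⊔N≤n)))
                         (*-congˡ (s-sum n (ℕ.≤-trans (ℕ.m≤n⊔m M N) M⊔N≤n)))))))
               0<ε
      ; total      = λ A (_ , Univ⊆A) → indicators-sum (Univ⊆A tt) (Univ⊆A tt)
      }

    abstract
      twoPoint-full : ∀ A → r ∈ set A → s ∈ set A → prob twoPoint A ≈ 1#
      twoPoint-full A = indicators-sum

      module _ (r<s : r < s) where
        private
          π : List (ℝ × BorelSet)
          π = (r , ｛ r ｝ᵇ) ∷ (s , ｛ s ｝ᵇ) ∷ []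

          r≉s : r ≉ s
          r≉s = proj₂ r<s

          prob-r : prob twoPoint ｛ r ｝ᵇ ≈ q
          prob-r = trans (+-cong (*-congˡ (indicator-yes refl)) (*-congˡ (indicator-no (λ s≈r → r≉s (sym s≈r)))))
            (solve 2 (λ q p → q :* con (+ 1) :+ p :* con (+ 0) := q) refl q p)

          prob-s : prob twoPoint ｛ s ｝ᵇ ≈ p
          prob-s = trans (+-cong (*-congˡ (indicator-no r≉s)) (*-congˡ (indicator-yes refl)))
            (solve 2 (λ q p → q :* con (+ 0) :+ p :* con (+ 1) := p) refl q p)

          Σ-two : ∀ F → Σ[ twoPoint ] F π ≈ q * F r + p * F s
          Σ-two F = trans (+-cong (*-congˡ prob-r) (+-congʳ (*-congˡ prob-s)))
            (solve 4 (λ q p x y → x :* q :+ (y :* p :+ con (+ 0)) := q :* x :+ p :* y) refl q p (F r) (F s))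

          partition : IsPartition twoPoint π
          partition = ((λ (x≈r , x≈s) → r≉s (trans (sym x≈r) x≈s)) ∷ []) ∷ [] ∷ []
                    , trans (Σ-two (λ _ → 1#)) (trans (+-cong (*-identityʳ q) (*-identityʳ p)) q+p≈1)

          exact : ∀ {f : ℝ → ℝ} {x t} → f x ≈ f t → f x ≤ f t + 0# × f t ≤ f x + 0#
          exact eq = ≤-reflexive (trans eq (sym (+-identityʳ _))) , ≤-reflexive (trans (sym eq) (sym (+-identityʳ _)))

          close-two : ∀ {f} → Continuous f → Close f 0# π
          close-two {f} cont = (λ x≈r → exact {f} (continuous⇒cong cont x≈r)) ∷ (λ x≈s → exact {f} (continuous⇒cong cont x≈s)) ∷ []

        -- The singletons of r and s form a partition on whose pieces f is constant up to `_≈_`.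
        -- Thus ε = 0 is admissible and the two bounds become an equality.
        twoPoint-expectation : ∀ {f} → Continuous f → ∃[ v ] (v ∈ 𝔼 twoPoint f × v ≈ q * f r + p * f s)
        twoPoint-expectation {f} cont =
          let v , v∈𝔼 = expectation-exists twoPoint {f} π partition ≤-refl (close-two cont) (continuous⇒measurable cont)
              v≤ , ≤v = expectation-bounds twoPoint {f} π partition ≤-refl (close-two cont) v∈𝔼
          in v , v∈𝔼 , trans (antisym (≤-respʳ-≈ (+0+0 _) v≤) (≤-respʳ-≈ (+0+0 _) ≤v)) (Σ-two f)
          where
          +0+0 : ∀ x → x + (0# + 0#) ≈ x
          +0+0 = solve 1 (λ x → x :+ (con (+ 0) :+ con (+ 0)) := x) refl

  abstract
    -- The weights are q = s / (s - r) and p = -r / (s - r), with d standing for 1 / (s - r). For r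
    -- = 0 they give the point mass at 0.
    balance : ∀ {r s} → r ≤ 0# → 0# < s → ∃[ q ] ∃[ p ] (0# ≤ q × 0# ≤ p × q + p ≈ 1# × q * r + p * s ≈ 0#)
    balance {r} {s} r≤0 0<s =
      let d , 0<d , [s-r]d≈1 = inverse-pos {s - r} (by₂< r≤0 0<s
            (solve 2 (λ r s → (s :- r) :- con (+ 0) := (con (+ 0) :- r) :+ (s :- con (+ 0))) refl r s))
      in s * d , (0# - r) * d , *-nonneg (<⇒≤ 0<s) (<⇒≤ 0<d) , *-nonneg (≤⇒0≤- r≤0) (<⇒≤ 0<d)
       , trans (solve 3 (λ r s d → s :* d :+ (con (+ 0) :- r) :* d := (s :- r) :* d) refl r s d) [s-r]d≈1
       , solve 3 (λ r s d → (s :* d) :* r :+ ((con (+ 0) :- r) :* d) :* s := con (+ 0)) refl r s d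

-- Strong duality between hedges and mean-zero laws.

module Duality (em : ExcludedMiddle (lsuc 0ℓ)) (𝓡 : CompleteOrderedField) where
  open OrderedField em 𝓡
  open Measure em 𝓡
  open Continuity em 𝓡
  open TwoPoint em 𝓡

  abstract
    convex-≤ : ∀ {q p x y z} → 0# ≤ q → 0# ≤ p → q + p ≈ 1# → x ≤ z → y ≤ z → q * x + p * y ≤ z
    convex-≤ {q} {p} {x} {y} {z} 0≤q 0≤p q+p≈1 x≤z y≤z = ≤-respʳ-≈
      (trans (solve 3 (λ q p z → q :* z :+ p :* z := (q :+ p) :* z) refl q p z) (trans (*-congʳ q+p≈1) (*-identityˡ z)))
      (+-mono-≤ (*-monoˡ-≤ 0≤q x≤z) (*-monoˡ-≤ 0≤p y≤z))

    *-bound : ∀ c {x e} → x ≤ e → - x ≤ e → c * x ≤ ∣ c ∣ * e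
    *-bound c {x} {e} x≤e -x≤e = [ positive , negative ]′ (≤-total 0# c)
      where
      0≤e : 0# ≤ e
      0≤e = [ (λ 0≤x → ≤-trans 0≤x x≤e) , (λ x≤0 → ≤-trans (by₁ x≤0 (solve 1 (λ x → (:- x) :- con (+ 0) := con (+ 0) :- x) refl x)) -x≤e) ]′ (≤-total 0# x)
      positive : 0# ≤ c → c * x ≤ ∣ c ∣ * e
      positive 0≤c = ≤-trans (*-monoˡ-≤ 0≤c x≤e) (*-monoʳ-≤ 0≤e (x≤∣x∣ c))
      negative : c ≤ 0# → c * x ≤ ∣ c ∣ * e
      negative c≤0 = ≤-trans (by₀ (*-nonneg (≤⇒0≤- c≤0) (≤⇒0≤- -x≤e))
          (solve 3 (λ c x e → (:- c) :* e :- c :* x := (con (+ 0) :- c) :* (e :- (:- x))) refl c x e))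
        (*-monoʳ-≤ 0≤e (-x≤∣x∣ c))

    continuous-id : Continuous id
    continuous-id x {ε} 0<ε = ε , 0<ε , λ y ∣y-x∣<ε → ∣y-x∣<ε

  module _ {f} (cont : Continuous f) (𝒰 : BorelSet) (bounded : Bounded (set 𝒰)) where

    -- Allowing r = 0 includes the point mass at 0 when 0 lies in 𝒰; the strict bound on s keeps r
    -- and s distinct.
    TwoPointValue : Pred ℝ 0ℓ
    TwoPointValue v = ∃[ r ] ∃[ s ] (r ∈ set 𝒰 × r ≤ 0# × s ∈ set 𝒰 × 0# < s ×
      ∃[ q ] ∃[ p ] (0# ≤ q × 0# ≤ p × q + p ≈ 1# × q * r + p * s ≈ 0# × v ≈ q * f r + p * f s))

    Gain : ℝ → Pred ℝ 0ℓ
    Gain Δ v = ∃[ R ] (R ∈ set 𝒰 × v ≈ f R - Δ * R)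

    MeanZero : Pred ProbabilityMeasure (lsuc 0ℓ)
    MeanZero = 𝒫 𝒰 ∩ (λ P → 𝔼 P id ≃ val 0#)

    abstract
      twoPointSup : ∃[ x ] (x ∈ set 𝒰 × 0# < x) → ∃[ x ] (x ∈ set 𝒰 × x < 0#) → ∃ (IsSup TwoPointValue)
      twoPointSup (s , s∈𝒰 , 0<s) (r , r∈𝒰 , r<0) =
        let q , p , 0≤q , 0≤p , q+p≈1 , mean = balance (<⇒≤ r<0) 0<s
            B , f≤B = cover-bounded (cover-exists cont 0<1 𝒰 bounded)
        in complete TwoPointValue
             (_ , r , s , r∈𝒰 , <⇒≤ r<0 , s∈𝒰 , 0<s , q , p , 0≤q , 0≤p , q+p≈1 , mean , refl)
             (B , λ (_ , _ , r∈𝒰 , _ , s∈𝒰 , _ , _ , _ , 0≤q , 0≤p , q+p≈1 , _ , v≈) →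
               ≤-respˡ-≈ (sym v≈) (convex-≤ 0≤q 0≤p q+p≈1 (f≤B r∈𝒰) (f≤B s∈𝒰)))

      -- Weak duality: a law of mean zero does not see the term Δ R, and an average never exceeds an
      -- upper bound of the averaged values.
      twoPoint≤gain : ∀ {D Δ v} → IsSup TwoPointValue D → IsSup (Gain Δ) v → D ≤ v
      twoPoint≤gain {D} {Δ} {v} (_ , D≤) (gain≤v , _) =
        D≤ λ (r , s , r∈𝒰 , _ , s∈𝒰 , _ , q , p , 0≤q , 0≤p , q+p≈1 , mean , w≈) →
          ≤-respˡ-≈ (sym (trans w≈ (hedged r s q p mean)))
            (convex-≤ 0≤q 0≤p q+p≈1 (gain≤v (r , r∈𝒰 , refl)) (gain≤v (s , s∈𝒰 , refl)))
        where
        hedged : ∀ r s q p → q * r + p * s ≈ 0# → q * f r + p * f s ≈ q * (f r - Δ * r) + p * (f s - Δ * s)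
        hedged r s q p mean = trans
          (solve 7 (λ r s q p x y d → q :* x :+ p :* y := (q :* (x :- d :* r) :+ p :* (y :- d :* s)) :+ d :* (q :* r :+ p :* s))
            refl r s q p (f r) (f s) Δ)
          (trans (+-congˡ (trans (*-congˡ mean) (zeroʳ Δ))) (+-identityʳ _))

      -- The two-point value is at most D; cleared of denominators.
      twoPoint-ineq : ∀ {D r s} → IsSup TwoPointValue D → r ∈ set 𝒰 → r ≤ 0# → s ∈ set 𝒰 → 0# < s →
                      0# ≤ s * (D - f r) + r * (f s - D)
      twoPoint-ineq {D} {r} {s} (≤D , _) r∈𝒰 r≤0 s∈𝒰 0<s = go (balance r≤0 0<s)
        where
        go : ∃[ q ] ∃[ p ] (0# ≤ q × 0# ≤ p × q + p ≈ 1# × q * r + p * s ≈ 0#) → 0# ≤ s * (D - f r) + r * (f s - D)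
        go (q , p , 0≤q , 0≤p , q+p≈1 , mean) = ≤-respʳ-≈ eq (*-nonneg 0≤s-r
            (≤⇒0≤- (≤D (r , s , r∈𝒰 , r≤0 , s∈𝒰 , 0<s , q , p , 0≤q , 0≤p , q+p≈1 , mean , refl))))
          where
          0≤s-r : 0# ≤ s - r
          0≤s-r = ≤⇒0≤- (≤-trans r≤0 (<⇒≤ 0<s))
          eq : (s - r) * (D - (q * f r + p * f s)) ≈ s * (D - f r) + r * (f s - D)
          eq = trans
            -- The identity is arranged so that q + p, 1 - (q + p) and q r + p s occur as factors,
            -- to be replaced by 1, 0 and 0; the weights themselves are never computed.
            (solve 7 (λ r s q p x y d →
                (s :- r) :* (d :- (q :* x :+ p :* y)) :=
                ((q :+ p) :* (s :* (d :- x) :+ r :* (y :- d))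
                  :+ (con (+ 1) :- (q :+ p)) :* ((s :- r) :* d))
                  :- (y :- x) :* (q :* r :+ p :* s))
              refl r s q p (f r) (f s) D)
            (trans (+-cong (+-cong (trans (*-congʳ q+p≈1) (*-identityˡ _))
                             (trans (*-congʳ (trans (+-congˡ (-‿cong q+p≈1)) (-‿inverseʳ 1#))) (zeroˡ _)))
                           (-‿cong (trans (*-congˡ mean) (zeroʳ _))))
              (solve 1 (λ z → (z :+ con (+ 0)) :- con (+ 0) := z) refl _))

    -- The optimal hedge is the supremum over s > 0 of the slopes (f s − D) / s.
    Slope : ℝ → Pred ℝ 0ℓ
    Slope D v = ∃[ s ] (s ∈ set 𝒰 × 0# < s × ∃[ k ] (0# < k × s * k ≈ 1# × v ≈ (f s - D) * k))

    abstract
      -- With j = 1 / (-r), the right side is the slope of the line from (r, f r) to (0, D).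
      -- Multiplying `twoPoint-ineq` by k j shows that it dominates every slope from a positive
      -- point. This both bounds `Slope D` and, by leastness, places Δ* below it.
      slope-bound : ∀ {D r j v} → IsSup TwoPointValue D → r ∈ set 𝒰 → r ≤ 0# → 0# < j → (- r) * j ≈ 1# →
                    Slope D v → v ≤ (D - f r) * j
      slope-bound {D} {r} {j} {v} isSup r∈𝒰 r≤0 0<j rj≈1 (s , s∈𝒰 , 0<s , k , 0<k , sk≈1 , v≈) =
        ≤-respˡ-≈ (sym v≈) (by₀ (*-nonneg (<⇒≤ (*-pos 0<k 0<j)) (twoPoint-ineq isSup r∈𝒰 r≤0 s∈𝒰 0<s)) (sym (trans
          (solve 6 (λ r s j k b a → (k :* j) :* (s :* b :+ r :* a) := (s :* k) :* (b :* j) :- ((:- r) :* j) :* (a :* k))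
            refl r s j k (D - f r) (f s - D))
          (+-cong (trans (*-congʳ sk≈1) (*-identityˡ _)) (-‿cong (trans (*-congʳ rj≈1) (*-identityˡ _)))))))

      neg-pos : ∀ {r} → r < 0# → 0# < - r
      neg-pos {r} r<0 = by₁< r<0 (solve 1 (λ r → (:- r) :- con (+ 0) := con (+ 0) :- r) refl r)

      slopeSup : ∀ {D} → IsSup TwoPointValue D → ∃[ x ] (x ∈ set 𝒰 × 0# < x) → ∃[ x ] (x ∈ set 𝒰 × x < 0#) → ∃ (IsSup (Slope D))
      slopeSup {D} isSup (s , s∈𝒰 , 0<s) (r , r∈𝒰 , r<0) =
        let k , 0<k , sk≈1 = inverse-pos 0<s
            j , 0<j , rj≈1 = inverse-pos (neg-pos r<0)
        in complete (Slope D) (_ , s , s∈𝒰 , 0<s , k , 0<k , sk≈1 , refl)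
             (_ , slope-bound isSup r∈𝒰 (<⇒≤ r<0) 0<j rj≈1)

      -- For R > 0 the claim says that Δ* is an upper bound of the slopes, for R < 0 that it is the
      -- least one. At R = 0 the hedge vanishes, and `twoPoint-ineq` with an arbitrary positive s₀
      -- reduces to f R ≤ D.
      superhedge : ∀ {D Δ} → IsSup TwoPointValue D → IsSup (Slope D) Δ → ∃[ x ] (x ∈ set 𝒰 × 0# < x) →
                   ∀ {R} → R ∈ set 𝒰 → f R - Δ * R ≤ D
      superhedge {D} {Δ} isSup (slope≤Δ , Δ≤) (s₀ , s₀∈𝒰 , 0<s₀) {R} R∈𝒰 =
        [ (λ 0≤R → [ zero-case 0≤R , positive-case ]′ (≤-<-connex R 0#)) , negative-case ]′ (≤-<-connex 0# R)
        where
        positive-case : 0# < R → f R - Δ * R ≤ D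
        positive-case 0<R =
          let k , 0<k , Rk≈1 = inverse-pos 0<R in
          by₁ (*-monoˡ-≤ (<⇒≤ 0<R) (slope≤Δ (R , R∈𝒰 , 0<R , k , 0<k , Rk≈1 , refl)))
            (trans (solve 4 (λ r d x δ → d :- (x :- δ :* r) := r :* δ :- con (+ 1) :* (x :- d)) refl R D (f R) Δ)
              (+-congˡ (-‿cong (trans (*-congʳ (sym Rk≈1)) (solve 3 (λ r k a → (r :* k) :* a := r :* (a :* k)) refl R k (f R - D))))))

        negative-case : R < 0# → f R - Δ * R ≤ D
        negative-case R<0 =
          let j , 0<j , Rj≈1 = inverse-pos (neg-pos R<0) in
          by₁ (*-monoˡ-≤ (<⇒≤ (neg-pos R<0)) (Δ≤ (slope-bound isSup R∈𝒰 (<⇒≤ R<0) 0<j Rj≈1)))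
            (trans (solve 4 (λ r d x δ → d :- (x :- δ :* r) := con (+ 1) :* (d :- x) :- (:- r) :* δ) refl R D (f R) Δ)
              (+-congʳ (trans (*-congʳ (sym Rj≈1)) (solve 3 (λ r j a → ((:- r) :* j) :* a := (:- r) :* (a :* j)) refl R j (D - f R)))))

        zero-case : 0# ≤ R → R ≤ 0# → f R - Δ * R ≤ D
        zero-case 0≤R R≤0 =
          let k , 0<k , sk≈1 = inverse-pos 0<s₀
              R≈0 = antisym R≤0 0≤R
          in by₀ (*-nonneg (<⇒≤ 0<k) (twoPoint-ineq isSup R∈𝒰 R≤0 s₀∈𝒰 0<s₀)) (sym (trans
               (solve 5 (λ r s k b a → k :* (s :* b :+ r :* a) := (s :* k) :* b :+ (k :* a) :* r) refl R s₀ k (D - f R) (f s₀ - D))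
               (trans (+-cong (trans (*-congʳ sk≈1) (*-identityˡ _)) (trans (*-congˡ R≈0) (trans (zeroʳ _) (sym (trans (*-congˡ R≈0) (zeroʳ Δ))))))
                 (solve 4 (λ r d x δ → (d :- x) :+ δ :* r := d :- (x :- δ :* r)) refl R D (f R) Δ))))

      -- The gain under Δ is the gain under Δ* plus (Δ* - Δ) R, and the latter is bounded on 𝒰. A
      -- minimum over Δ is only defined if every worst case is finite.
      gainSup : ∀ {D Δ*} → (∀ {R} → R ∈ set 𝒰 → f R - Δ* * R ≤ D) → ∃[ x ] (x ∈ set 𝒰 × 0# < x) → ∀ Δ → ∃ (IsSup (Gain Δ))
      gainSup {D} {Δ*} hedge (s , s∈𝒰 , _) Δ =
        let M , 𝒰≤M = bounded in
        complete (Gain Δ) (_ , s , s∈𝒰 , refl) (D + ∣ Δ* - Δ ∣ * M , λ {v} (R , R∈𝒰 , v≈) → ≤-respˡ-≈ (sym v≈)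
          (by₂ (hedge R∈𝒰) (*-bound (Δ* - Δ) (≤-trans (x≤∣x∣ R) (𝒰≤M R∈𝒰)) (≤-trans (-x≤∣x∣ R) (𝒰≤M R∈𝒰)))
            (solve 6 (λ d b x δ r e → (d :+ b) :- (x :- δ :* r) := (d :- (x :- e :* r)) :+ (b :- (e :- δ) :* r))
              refl D (∣ Δ* - Δ ∣ * M) (f R) Δ R Δ*)))

      gainSup-optimal : ∀ {D Δ*} → IsSup TwoPointValue D → (∀ {R} → R ∈ set 𝒰 → f R - Δ* * R ≤ D) →
                        ∃ (IsSup (Gain Δ*)) → IsSup (Gain Δ*) D
      gainSup-optimal isSup hedge (v , gain) =
        (λ (R , R∈𝒰 , w≈) → ≤-respˡ-≈ (sym w≈) (hedge R∈𝒰)) , λ gain≤u → ≤-trans (twoPoint≤gain isSup gain) (proj₂ gain gain≤u)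

      expectation-defined : ∀ {P} → P ∈ 𝒫 𝒰 → Satisfiable (𝔼 P f)
      expectation-defined {P} full =
        let κ = cover-exists cont 0<1 𝒰 bounded in
        Integration.expectation-exists em 𝓡 P (pieces κ) (cover-mass κ P full) (<⇒≤ 0<1) (close κ) (continuous⇒measurable cont)

      expectation≤hedge : ∀ {D Δ*} → (∀ {R} → R ∈ set 𝒰 → f R - Δ* * R ≤ D) →
                          ∀ {P} → P ∈ MeanZero → ∀ {w} → w ∈ 𝔼 P f → w ≤ D
      expectation≤hedge {D} {Δ} hedge {P} (full , m , m∈𝔼 , m≈0) {w} w∈𝔼 =
        -- The expectation of f costs 2 ε. Mean zero leaves the sum of the tags within 2 ε of 0,
        -- which the hedge multiplies by at most |Δ|.
        ≤-by-approximation {(1# + 1#) + ∣ Δ ∣ * (1# + 1#)}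
          (0≤-+ 0≤2 (*-nonneg (0≤∣x∣ Δ) 0≤2)) λ 0<ε → estimate 0<ε (cover-exists cont 0<ε 𝒰 bounded)
        where
        0≤2 : 0# ≤ 1# + 1#
        0≤2 = 0≤-+ (<⇒≤ 0<1) (<⇒≤ 0<1)

        estimate : ∀ {ε} → 0# < ε → Cover f ε 𝒰 → w ≤ D + ((1# + 1#) + ∣ Δ ∣ * (1# + 1#)) * ε
        estimate {ε} 0<ε κ =
          by₃ (proj₁ bounds-f) sum-hedge Δ-bound
            (solve 6 (λ w s d δt a ε → (d :+ ((con (+ 1) :+ con (+ 1)) :+ a :* (con (+ 1) :+ con (+ 1))) :* ε) :- w :=
                (((s :+ (ε :+ ε)) :- w)) :+ (((d :* con (+ 1) :+ δt) :- s) :+ ((a :* (ε :+ ε)) :- δt)))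
              refl w (Σ[ P ] f π) D (Δ * Σ[ P ] id π) ∣ Δ ∣ ε)
          where
          π : List (ℝ × BorelSet)
          π = pieces κ
          mass : IsPartition P π
          mass = cover-mass κ P full
          bounds-f : w ≤ Σ[ P ] f π + (ε + ε) × Σ[ P ] f π ≤ w + (ε + ε)
          bounds-f = Integration.expectation-bounds em 𝓡 P π mass (<⇒≤ 0<ε) (close κ) w∈𝔼
          bounds-id : m ≤ Σ[ P ] id π + (ε + ε) × Σ[ P ] id π ≤ m + (ε + ε)
          bounds-id = Integration.expectation-bounds em 𝓡 P {id} π mass (<⇒≤ 0<ε) (close-id κ) m∈𝔼
          Δ-bound : Δ * Σ[ P ] id π ≤ ∣ Δ ∣ * (ε + ε)
          Δ-bound = *-bound Δ
            (≤-respʳ-≈ (trans (+-congʳ m≈0) (+-identityˡ _)) (proj₂ bounds-id))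
            (by₁ (≤-respˡ-≈ m≈0 (proj₁ bounds-id))
              (solve 2 (λ t e → e :- (:- t) := (t :+ e) :- con (+ 0)) refl (Σ[ P ] id π) (ε + ε)))
          sum-hedge : Σ[ P ] f π ≤ D * 1# + Δ * Σ[ P ] id π
          sum-hedge = ≤-respʳ-≈ (trans (Σ-linear P D Δ (λ _ → 1#) id π) (+-congʳ (*-congˡ (proj₂ mass))))
            -- The hedge inequality is summed at the tags, which lie in 𝒰. Writing D as `D * 1#`
            -- gives the shape of `Σ-linear`, with total mass 1 as the coefficient of D.
            (Σ-mono P {f} {λ t → D * 1# + Δ * t} π (All.map (λ {(t , _)} (t∈𝒰 , _) → by₁ (hedge t∈𝒰)
              (solve 4 (λ d δ t x → (d :* con (+ 1) :+ δ :* t) :- x := d :- (x :- δ :* t)) refl D Δ t (f t))) (inside κ)))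

      expectationSup : ∀ {D Δ*} → IsSup TwoPointValue D → (∀ {R} → R ∈ set 𝒰 → f R - Δ* * R ≤ D) →
                       D ∈ supOver MeanZero (λ P → 𝔼 P f)
      expectationSup {D} (_ , D≤) hedge =
          (λ (full , _) → expectation-defined full)
        , (λ (P , P∈ , w∈𝔼) → expectation≤hedge hedge P∈ w∈𝔼)
        -- Each two-point value is itself an expectation under an admissible law, so an upper bound
        -- of the expectations also bounds D.
        , λ {u} values≤u → D≤ λ {v} (r , s , r∈𝒰 , r≤0 , s∈𝒰 , 0<s , q , p , 0≤q , 0≤p , q+p≈1 , mean , v≈) →
            let P = twoPoint 0≤q 0≤p q+p≈1 r s
                r<s = ≤-<-trans r≤0 0<s
                m , m∈𝔼 , m≈ = twoPoint-expectation 0≤q 0≤p q+p≈1 r s r<s continuous-id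
                w , w∈𝔼 , w≈ = twoPoint-expectation 0≤q 0≤p q+p≈1 r s r<s cont
            in ≤-respˡ-≈ (trans w≈ (sym v≈))
                 (values≤u (P , (twoPoint-full 0≤q 0≤p q+p≈1 r s 𝒰 r∈𝒰 s∈𝒰 , m , m∈𝔼 , trans m≈ mean) , w∈𝔼))

-- The extrema over the exercise decision θ and the hedge Δ.

module Game (em : ExcludedMiddle (lsuc 0ℓ)) (𝓡 : CompleteOrderedField) where
  open OrderedField em 𝓡
  open Continuity em 𝓡
  open Duality em 𝓡

  isSup-resp : ∀ {ℓ} {A : Pred ℝ ℓ} {s t} → s ≈ t → IsSup A s → IsSup A t
  isSup-resp s≈t (A≤s , s≤) = (λ x∈A → ≤-respʳ-≈ s≈t (A≤s x∈A)) , λ A≤u → ≤-respˡ-≈ s≈t (s≤ A≤u)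

  module _ {f} (cont : Continuous f) (c : ℝ) (𝒰 : BorelSet) (bounded : Bounded (set 𝒰))
           (pos : ∃[ x ] (x ∈ set 𝒰 × 0# < x)) (neg : ∃[ x ] (x ∈ set 𝒰 × x < 0#)) where

    payoff : ℝ → ℝ → ℝ → ℝ
    payoff Δ θ R = (f R - Δ * R) * (1# - θ) + c * θ

    worst : ℝ → ℝ → Expr 0ℓ
    worst Δ θ = sup[ R ∈ set 𝒰 ] val (payoff Δ θ R)

    abstract
      payoff-0 : ∀ {Δ θ R} → θ ≈ 0# → payoff Δ θ R ≈ f R - Δ * R
      payoff-0 {Δ} {θ} {R} θ≈0 = trans (+-cong (*-congˡ (+-congˡ (-‿cong θ≈0))) (*-congˡ θ≈0))
        (solve 2 (λ x c → x :* (con (+ 1) :- con (+ 0)) :+ c :* con (+ 0) := x) refl (f R - Δ * R) c)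

      payoff-1 : ∀ {Δ θ R} → θ ≈ 1# → payoff Δ θ R ≈ c
      payoff-1 {Δ} {θ} {R} θ≈1 = trans (+-cong (*-congˡ (+-congˡ (-‿cong θ≈1))) (*-congˡ θ≈1))
        (solve 2 (λ x c → x :* (con (+ 1) :- con (+ 1)) :+ c :* con (+ 1) := c) refl (f R - Δ * R) c)

      worst-0 : ∀ {Δ θ v} → θ ≈ 0# → IsSup (Gain cont 𝒰 bounded Δ) v → v ∈ worst Δ θ
      worst-0 {Δ} {θ} θ≈0 (gain≤v , v≤) = (λ _ → _ , refl)
        , (λ (R , R∈𝒰 , w≈) → gain≤v (R , R∈𝒰 , trans w≈ (payoff-0 {Δ} {θ} {R} θ≈0)))
        , λ values≤u → v≤ λ (R , R∈𝒰 , w≈) → values≤u (R , R∈𝒰 , trans w≈ (sym (payoff-0 {Δ} {θ} {R} θ≈0)))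

      worst-1 : ∀ {Δ θ} → θ ≈ 1# → c ∈ worst Δ θ
      worst-1 {Δ} {θ} θ≈1 = (λ _ → _ , refl)
        , (λ (R , _ , w≈) → ≤-reflexive (trans w≈ (payoff-1 {Δ} {θ} {R} θ≈1)))
        -- The supremum of the constant c equals c because 𝒰 has a point; the positive one serves.
        , λ values≤u → values≤u (proj₁ pos , proj₁ (proj₂ pos) , sym (payoff-1 {Δ} {θ} {proj₁ pos} θ≈1))

      worst-unique : ∀ {Δ θ v w} → v ∈ worst Δ θ → w ∈ worst Δ θ → v ≈ w
      worst-unique (_ , v-sup) (_ , w-sup) = sup-unique v-sup w-sup

      worst-resp : ∀ {Δ θ v w} → v ≈ w → v ∈ worst Δ θ → w ∈ worst Δ θ
      worst-resp v≈w (defined , v-sup) = defined , isSup-resp v≈w v-sup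

      twoPoint-sup : ∃ (IsSup (TwoPointValue cont 𝒰 bounded))
      twoPoint-sup = twoPointSup cont 𝒰 bounded pos neg

      D : ℝ
      D = proj₁ twoPoint-sup

      D-sup : IsSup (TwoPointValue cont 𝒰 bounded) D
      D-sup = proj₂ twoPoint-sup

      slope-sup : ∃ (IsSup (Slope cont 𝒰 bounded D))
      slope-sup = slopeSup cont 𝒰 bounded D-sup pos neg

      Δ* : ℝ
      Δ* = proj₁ slope-sup

      hedge : ∀ {R} → R ∈ set 𝒰 → f R - Δ* * R ≤ D
      hedge = superhedge cont 𝒰 bounded D-sup (proj₂ slope-sup) pos

      gain-sup : ∀ Δ → ∃ (IsSup (Gain cont 𝒰 bounded Δ))
      gain-sup = gainSup cont 𝒰 bounded hedge pos

      gain-optimal : IsSup (Gain cont 𝒰 bounded Δ*) D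
      gain-optimal = gainSup-optimal cont 𝒰 bounded D-sup hedge (gain-sup Δ*)

      worst-defined : ∀ {Δ θ} → θ ∈ ｛0,1｝ → Satisfiable (worst Δ θ)
      worst-defined {Δ} (inj₁ θ≈0) = proj₁ (gain-sup Δ) , worst-0 θ≈0 (proj₂ (gain-sup Δ))
      worst-defined {Δ} (inj₂ θ≈1) = c , worst-1 {Δ} θ≈1

      max-worst : ∀ {Δ v} → IsSup (Gain cont 𝒰 bounded Δ) v → (v ⊔ c) ∈ (max[ θ ∈ ｛0,1｝ ] worst Δ θ)
      max-worst {Δ} {v} gain = worst-defined , attained (⊔-cases v c) , λ { (_ , θ∈ , w∈) → upper θ∈ w∈ }
        where
        attained : (c ≤ v × v ⊔ c ≈ v) ⊎ (v ≤ c × v ⊔ c ≈ c) → Values ｛0,1｝ (worst Δ) (v ⊔ c)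
        attained (inj₁ (_ , eq)) = 0# , inj₁ refl , worst-resp {Δ} {0#} (sym eq) (worst-0 refl gain)
        attained (inj₂ (_ , eq)) = 1# , inj₂ refl , worst-resp {Δ} {1#} (sym eq) (worst-1 {Δ} refl)
        upper : ∀ {θ w} → θ ∈ ｛0,1｝ → w ∈ worst Δ θ → w ≤ v ⊔ c
        upper {θ} (inj₁ θ≈0) w∈ = ≤-respˡ-≈ (worst-unique {Δ} {θ} (worst-0 θ≈0 gain) w∈) (x≤x⊔y v c)
        upper {θ} (inj₂ θ≈1) w∈ = ≤-respˡ-≈ (worst-unique {Δ} {θ} (worst-1 {Δ} θ≈1) w∈) (y≤x⊔y v c)

      -- The maximum over θ is the worst gain joined with c. Joining with a constant is monotone, so
      -- Δ*, which minimises the worst gain, is optimal here too.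
      minimax-value : (D ⊔ c) ∈ (min[ Δ ∈ Univ ] max[ θ ∈ ｛0,1｝ ] worst Δ θ)
      minimax-value = (λ {Δ} _ → _ , max-worst (proj₂ (gain-sup Δ)))
        , (Δ* , tt , max-worst gain-optimal)
        , λ (Δ , _ , _ , _ , worst≤w) → ⊔-lub
            (≤-trans (twoPoint≤gain cont 𝒰 bounded D-sup (proj₂ (gain-sup Δ)))
              (worst≤w (0# , inj₁ refl , worst-0 refl (proj₂ (gain-sup Δ)))))
            (worst≤w (1# , inj₂ refl , worst-1 {Δ} refl))

      min-worst-0 : ∀ {θ} → θ ≈ 0# → D ∈ (min[ Δ ∈ Univ ] worst Δ θ)
      min-worst-0 {θ} θ≈0 = (λ {Δ} _ → worst-defined {Δ} (inj₁ θ≈0))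
        , (Δ* , tt , worst-0 θ≈0 gain-optimal)
        , λ (Δ , _ , w∈) → ≤-respʳ-≈ (worst-unique {Δ} {θ} (worst-0 θ≈0 (proj₂ (gain-sup Δ))) w∈)
            (twoPoint≤gain cont 𝒰 bounded D-sup (proj₂ (gain-sup Δ)))

      min-worst-1 : ∀ {θ} → θ ≈ 1# → c ∈ (min[ Δ ∈ Univ ] worst Δ θ)
      min-worst-1 {θ} θ≈1 = (λ {Δ} _ → worst-defined {Δ} (inj₂ θ≈1))
        -- After early exercise the hedge has no effect; any Δ attains the minimum.
        , (0# , tt , worst-1 {0#} θ≈1)
        , λ (Δ , _ , w∈) → ≤-reflexive (worst-unique {Δ} {θ} (worst-1 {Δ} θ≈1) w∈)

      -- Once θ is fixed, the minimum over Δ is D without exercise and c with it, so the order of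
      -- the two extrema does not change the value.
      maximin-value : (D ⊔ c) ∈ (max[ θ ∈ ｛0,1｝ ] min[ Δ ∈ Univ ] worst Δ θ)
      maximin-value = [ (λ θ≈0 → D , min-worst-0 θ≈0) , (λ θ≈1 → c , min-worst-1 θ≈1) ]′
        , attained (⊔-cases D c)
        , λ { (_ , inj₁ θ≈0 , _ , _ , w≤) → ≤-trans (w≤ (Δ* , tt , worst-0 θ≈0 gain-optimal)) (x≤x⊔y D c)
            ; (_ , inj₂ θ≈1 , _ , _ , w≤) → ≤-trans (w≤ (0# , tt , worst-1 {0#} θ≈1)) (y≤x⊔y D c) }
        where
        min-resp : ∀ {θ v w} → v ≈ w → v ∈ (min[ Δ ∈ Univ ] worst Δ θ) → w ∈ (min[ Δ ∈ Univ ] worst Δ θ)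
        min-resp {θ} v≈w (defined , (Δ , _ , v∈) , v≤) =
          defined , (Δ , tt , worst-resp {Δ} {θ} v≈w v∈) , λ x∈ → ≤-respˡ-≈ v≈w (v≤ x∈)
        attained : (c ≤ D × D ⊔ c ≈ D) ⊎ (D ≤ c × D ⊔ c ≈ c) →
                   Values ｛0,1｝ (λ θ → min[ Δ ∈ Univ ] worst Δ θ) (D ⊔ c)
        attained (inj₁ (_ , eq)) = 0# , inj₁ refl , min-resp (sym eq) (min-worst-0 refl)
        attained (inj₂ (_ , eq)) = 1# , inj₂ refl , min-resp (sym eq) (min-worst-1 refl)

      dual-value : (D ⊔ c) ∈ max₂ (sup[ P ∈ MeanZero cont 𝒰 bounded ] 𝔼 P f) (val c)
      dual-value = D , c , expectationSup cont 𝒰 bounded D-sup hedge , refl , refl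

      duality : (min[ Δ ∈ Univ ] max[ θ ∈ ｛0,1｝ ] worst Δ θ) ≃ (max[ θ ∈ ｛0,1｝ ] min[ Δ ∈ Univ ] worst Δ θ)
              × (max[ θ ∈ ｛0,1｝ ] min[ Δ ∈ Univ ] worst Δ θ) ≃
                max₂ (sup[ P ∈ MeanZero cont 𝒰 bounded ] 𝔼 P f) (val c)
      duality = (D ⊔ c , minimax-value , maximin-value) , (D ⊔ c , maximin-value , dual-value)

lemma5p1 :
  ExcludedMiddle (lsuc 0ℓ) →
  (𝓡 : CompleteOrderedField) → let open RealAnalysis 𝓡 in
  (S₀ : ℝ) → 0# < S₀ →
  (g : ℝ → ℝ) → Continuous g →
  (𝒰 : BorelSet) → Bounded (set 𝒰) →
  ∃[ x ] (x ∈ set 𝒰 × 0# < x) →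
  ∃[ x ] (x ∈ set 𝒰 × x < 0#) →
  let
    minimax = min[ Δ ∈ Univ ] max[ θ ∈ ｛0,1｝ ] sup[ R ∈ set 𝒰 ]
      val ((g (S₀ * (1# + R)) - Δ * R) * (1# - θ) + g S₀ * θ)
    maximin = max[ θ ∈ ｛0,1｝ ] min[ Δ ∈ Univ ] sup[ R ∈ set 𝒰 ]
      val ((g (S₀ * (1# + R)) - Δ * R) * (1# - θ) + g S₀ * θ)
    dual = max₂
      (sup[ P ∈ 𝒫 𝒰 ∩ (λ P → 𝔼 P (λ R → R) ≃ val 0#) ] 𝔼 P (λ R → g (S₀ * (1# + R))))
      (val (g S₀))
  in (minimax ≃ maximin) × (maximin ≃ dual)
lemma5p1 em 𝓡 S₀ 0<S₀ g cont 𝒰 bounded pos neg =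
  duality (continuous-∘affine S₀ 0<S₀ cont) (g S₀) 𝒰 bounded pos neg
  where
  open Continuity em 𝓡
  open Game em 𝓡
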